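{- Let $p,q,l$ be integers with $p,q\ge 3$, $l\ge 1$, let $G=\infty(p,q,l)$ and let $\Gamma(G)=(G,\sigma)$ be any signed graph with underlying graph $G$. Let $\Gamma(C_p)$ and $\Gamma(C_q)$ denote the two signed cycles of $\Gamma(G)$ (of lengths $p$ and $q$), and $s(\Gamma(C_p))$, $s(\Gamma(C_q))$ their numbers of negative edges. (1) If $p$ and $q$ are both odd, then: $\eta(\Gamma(G))=0$ if $l$ is even; $\eta(\Gamma(G))=0$ if $l$ is odd and $s(\Gamma(C_p))-s(\Gamma(C_q))+\frac{q-p}{2}\equiv 0\pmod 2$; $\eta(\Gamma(G))=1$ if $l=1$ and $s(\Gamma(C_p))-s(\Gamma(C_q))+\frac{q-p}{2}\equiv 1\pmod 2$; $\eta(\Gamma(G))\ge 1$ if $l\ge 3$ is odd and $s(\Gamma(C_p))-s(\Gamma(C_q))+\frac{q-p}{2}\equiv 1\pmod 2$. (2) If $p$ and $q$ have different parities, say $p$ is even, then $\eta(\Gamma(G))=0$ if $\eta(\Gamma(C_p))=0$, and $\eta(\Gamma(G))=1$ if $\eta(\Gamma(C_p))=2$. (3) If $p$ and $q$ are both even, then: $\eta(\Gamma(G))=3$ if $l$ is odd and $\eta(\Gamma(C_p))=\eta(\Gamma(C_q))=2$; $\eta(\Gamma(G))=1$ if $l$ is odd and $\eta(\Gamma(C_p))\cdot\eta(\Gamma(C_q))=0$; $\eta(\Gamma(G))=2$ if $l$ is even and ($\eta(\Gamma(C_p))=2$ or $\eta(\Gamma(C_q))=2$); $\eta(\Gamma(G))=0$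 if $l$ is even and $\eta(\Gamma(C_p))=\eta(\Gamma(C_q))=0$.
   Context: A signed graph $\Gamma(G)=(G,\sigma)$ consists of a simple graph $G=(V,E)$ and a map $\sigma:E\to\{+,-\}$; its adjacency matrix has $(i,j)$ entry $\sigma(v_iv_j)$ if $v_iv_j\in E$ and $0$ otherwise, and its nullity $\eta(\cdot)$ is the multiplicity of the eigenvalue $0$ of this matrix; subgraphs inherit signs. The graph $\infty(p,q,l)$ is obtained from two vertex-disjoint cycles $C_p$ and $C_q$ by joining a vertex of $C_p$ and a vertex of $C_q$ by a path $P_l$ on $l$ vertices (of length $l-1$); when $l=1$ these two vertices are identified. Thus it has $p+q+l-2$ vertices. -}

module Defs where

open import Data.Bool using (Bool; true; false; if_then_else_; _∨_; _∧_)
open import Data.Nat using (ℕ; zero; suc; _+_; _∸_; _≟_)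
open import Data.Fin using (Fin; toℕ)
import Data.Fin as F
open import Data.Rational using (ℚ; 0ℚ; 1ℚ; -_; _*_) renaming (_+_ to _+ℚ_)
open import Data.Product using (Σ; _×_)
open import Relation.Nullary using (¬_)
open import Relation.Nullary.Decidable using (⌊_⌋)
open import Relation.Binary.PropositionalEquality using (_≡_)

ΣF : ∀ {n} → (Fin n → ℚ) → ℚ
ΣF {zero}  f = 0ℚ
ΣF {suc n} f = f F.zero +ℚ ΣF (λ i → f (F.suc i))

Matrix : ℕ → Set
Matrix n = Fin n → Fin n → ℚ

InKernel : ∀ {n} → Matrix n → (Fin n → ℚ) → Set
InKernel A x = ∀ i → ΣF (λ j → A i j * x j) ≡ 0ℚ

LinIndep : ∀ {n k} → (Fin k → Fin n → ℚ) → Set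
LinIndep {n} {k} v =
  (c : Fin k → ℚ) → (∀ j → ΣF (λ t → c t * v t j) ≡ 0ℚ) → ∀ t → c t ≡ 0ℚ

NullityAtLeast : ∀ {n} → Matrix n → ℕ → Set
NullityAtLeast {n} A k =
  Σ (Fin k → Fin n → ℚ) (λ v → (∀ t → InKernel A (v t)) × LinIndep v)

-- η(A) = k (dimension of the null space; for a symmetric real matrix
-- this is the multiplicity of the eigenvalue 0)
Nullity : ∀ {n} → Matrix n → ℕ → Set
Nullity A k = NullityAtLeast A k × ¬ NullityAtLeast A (suc k)

-- The graph ∞(p,q,l) on vertices 0 .. p+q+l-3 :
--   C_p : 0,1,...,p-1   (edges i~i+1 and 0~p-1)
--   P_l : p-1, p, ..., p+l-2   (edges i~i+1)
--   C_q : p+l-2, ..., p+l+q-3  (edges i~i+1 and (p+l-2)~(p+l+q-3))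
-- (for l = 1 the path is the single shared vertex p-1).

numVertices : ℕ → ℕ → ℕ → ℕ
numVertices p q l = p + q + l ∸ 2

qStart : ℕ → ℕ → ℕ
qStart p l = p + l ∸ 2

_==_ : ℕ → ℕ → Bool
a == b = ⌊ a ≟ b ⌋

isPair : ℕ → ℕ → ℕ → ℕ → Bool
isPair a b x y = ((a == x) ∧ (b == y)) ∨ ((a == y) ∧ (b == x))

-- adjacency relation of ∞(p,q,l) (on vertices < numVertices p q l)
isEdge : ℕ → ℕ → ℕ → ℕ → ℕ → Bool
isEdge p q l a b =
  (suc a == b) ∨ (suc b == a) ∨ isPair a b 0 (p ∸ 1)
    ∨ isPair a b (qStart p l) (p + q + l ∸ 3)

data Sign : Set where
  pos neg : Sign

sgn : Sign → ℚ
sgn pos = 1ℚ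
sgn neg = - 1ℚ

isNeg : Sign → Bool
isNeg pos = false
isNeg neg = true

-- A signing of ∞(p,q,l) is given by σ : ℕ → ℕ → Sign, symmetric;
-- only its values on edges matter.
Symmetric : (ℕ → ℕ → Sign) → Set
Symmetric σ = ∀ a b → σ a b ≡ σ b a

entry : ℕ → ℕ → ℕ → (ℕ → ℕ → Sign) → ℕ → ℕ → ℚ
entry p q l σ a b = if isEdge p q l a b then sgn (σ a b) else 0ℚ

adjG : (p q l : ℕ) → (ℕ → ℕ → Sign) → Matrix (numVertices p q l)
adjG p q l σ i j = entry p q l σ (toℕ i) (toℕ j)

induced : (p q l : ℕ) → (ℕ → ℕ → Sign) → (off m : ℕ) → Matrix m
induced p q l σ off m i j = entry p q l σ (off + toℕ i) (off + toℕ j)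

adjCp : (p q l : ℕ) → (ℕ → ℕ → Sign) → Matrix p
adjCp p q l σ = induced p q l σ 0 p

adjCq : (p q l : ℕ) → (ℕ → ℕ → Sign) → Matrix q
adjCq p q l σ = induced p q l σ (qStart p l) q

sumℕ : ℕ → (ℕ → ℕ) → ℕ
sumℕ zero    f = 0
sumℕ (suc n) f = sumℕ n f + f n

b2n : Bool → ℕ
b2n true  = 1
b2n false = 0

negEdges : (p q l : ℕ) → (ℕ → ℕ → Sign) → (off m : ℕ) → ℕ
negEdges p q l σ off m =
  sumℕ m (λ b → sumℕ b (λ a →
    b2n (isEdge p q l (off + a) (off + b) ∧ isNeg (σ (off + a) (off + b)))))

sCp : (p q l : ℕ) → (ℕ → ℕ → Sign) → ℕ
sCp p q l σ = negEdges p q l σ 0 p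

sCq : (p q l : ℕ) → (ℕ → ℕ → Sign) → ℕ
sCq p q l σ = negEdges p q l σ (qStart p l) q

{-# OPTIONS --safe #-}
module Submission where

-- Multiplying the i-th coordinate by the product of the signs of the edges {0,1}, …, {i-1,i} makes
-- all edges {i,i+1} positive, so only the signs α, β of the two edges closing the cycles remain:
-- these are (-1)^s(C_p) and (-1)^s(C_q). The kernel equations then become the recurrence
-- y(i+2) = - y(i), perturbed only at the two attaching vertices, and a kernel vector is determined by
-- u = y(0), v = y(1) and b = β y(last), subject to three closing conditions. Let w be the value at
-- the attaching vertex of a cycle and g the sum of the values at its two neighbours in the cycle.
-- Then g = 2κw with κ = ±1 if the cycle is odd, g = 0 if it is even of nullity 2 (with one further
-- free parameter) and w = 0 if it is even of nullity 0 (with none). The path transports the pair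
-- (g , w), up to signs, unchanged if l is odd and with the components exchanged if l is even, so the
-- nullity is read off from the relative position of two lines in a plane.

open import Defs
open import Data.Bool using (Bool; true; false; if_then_else_; _∨_; _∧_; T)
open import Data.Bool.Properties using (T-∨; T-∧; ∨-identityʳ; ∧-zeroʳ; ∨-comm)
open import Data.Empty using (⊥)
open import Data.Fin using (Fin; toℕ; fromℕ<; punchIn)
import Data.Fin as F
open import Data.Fin.Patterns using (0F; 1F; 2F)
import Data.Fin.Properties as Fin
open import Data.Integer as ℤ using (_-_; ∣_∣; _⊖_) renaming (_+_ to _+ℤ_)
import Data.Integer.Properties as ℤ
import Data.Integer.Tactic.RingSolver as ℤ-Solver
open import Data.Nat as ℕ using (ℕ; zero; suc; _≤_; _<_; z≤n; s≤s; _≡ᵇ_; _%_; _/_)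
open import Data.Nat.DivMod using (m≡m%n+[m/n]*n)
import Data.Nat.Properties as ℕ
import Data.Nat.Tactic.RingSolver as ℕ-Solver
open import Data.Product using (Σ; ∃; _×_; _,_; proj₁; proj₂)
open import Data.Rational using (ℚ; 0ℚ; 1ℚ; ½; 1/_; -_; _+_; _*_; ≢-nonZero)
open import Data.Rational.Properties
  using ( _≟_; +-*-commutativeRing; +-assoc; +-identityˡ; +-identityʳ; +-inverseʳ; *-assoc; *-comm
        ; *-identityˡ; *-identityʳ; *-zeroˡ; *-zeroʳ; *-inverseʳ; *-distribˡ-+; neg-distribˡ-*)
open import Data.Rational.Solver using (module +-*-Solver)
open import Data.Sum using (_⊎_; inj₁; inj₂; [_,_])
open import Data.Vec.Functional using ([]; _∷_; insertAt)
open import Data.Vec.Functional.Properties using (insertAt-lookup; insertAt-punchIn)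
open import Algebra.Bundles using (CommutativeRing)
open import Algebra.Properties.Semiring.Sum (CommutativeRing.semiring +-*-commutativeRing)
  using (sum; sum-cong-≗; sum-remove; ∑-distrib-+; ∑-comm; *-distribˡ-sum)
open import Function using (_∘_; _⇔_; mk⇔; Equivalence)
open import Relation.Nullary using (¬_; yes; no; contradiction; ¬?)
open import Relation.Nullary.Decidable using (decidable-stable; isYes≗does; toWitness; dec-true; dec-false)
open import Relation.Binary.PropositionalEquality hiding ([_])

open +-*-Solver
open Equivalence using (to; from)

-- Two obstacles shape the argument. At the attaching vertex of the second cycle the recurrence
-- needs the value at the last vertex, which it has not reached yet; so `b` is guessed in advance,
-- and the correctness of the guess becomes one of the closing conditions. And for `l = 1` both
-- cycles perturb the same row. Both are met by one device: the value in front of an attaching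
-- vertex is replaced by the sum of all its neighbours except the next one, chord included. From
-- there on the recurrence is unperturbed, and `l = 1` is just a path of zero steps. A kernel vector
-- and its parameters determine each other linearly, so every nullity is the dimension of a subspace
-- of the space of triples (u, v, b): bounded above by elimination, and below by vectors that are
-- diagonal in chosen coordinates.

-- Finite sums and linear dependence over the rationals

ΣF≡sum : ∀ {n} (f : Fin n → ℚ) → ΣF f ≡ sum f
ΣF≡sum {zero}  f = refl
ΣF≡sum {suc n} f = cong (f F.zero +_) (ΣF≡sum (f ∘ F.suc))

ΣF-cong : ∀ {n} {f g : Fin n → ℚ} → (∀ i → f i ≡ g i) → ΣF f ≡ ΣF g
ΣF-cong {zero}  e = refl
ΣF-cong {suc n} e = cong₂ _+_ (e F.zero) (ΣF-cong (e ∘ F.suc))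

ΣF-zero : ∀ {n} {f : Fin n → ℚ} → (∀ i → f i ≡ 0ℚ) → ΣF f ≡ 0ℚ
ΣF-zero {zero}  e = refl
ΣF-zero {suc n} e = trans (cong₂ _+_ (e F.zero) (ΣF-zero (e ∘ F.suc))) (+-identityˡ 0ℚ)

ΣF-distrib-+ : ∀ {n} (f g : Fin n → ℚ) → ΣF (λ i → f i + g i) ≡ ΣF f + ΣF g
ΣF-distrib-+ f g =
  trans (ΣF≡sum (λ i → f i + g i))
    (trans (∑-distrib-+ f g) (sym (cong₂ _+_ (ΣF≡sum f) (ΣF≡sum g))))

*-distribˡ-ΣF : ∀ {n} a (f : Fin n → ℚ) → a * ΣF f ≡ ΣF (λ i → a * f i)
*-distribˡ-ΣF a f =
  trans (cong (a *_) (ΣF≡sum f)) (trans (*-distribˡ-sum a f) (sym (ΣF≡sum (λ i → a * f i))))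

ΣF-comm : ∀ {m n} (f : Fin m → Fin n → ℚ) →
  ΣF (λ i → ΣF (λ j → f i j)) ≡ ΣF (λ j → ΣF (λ i → f i j))
ΣF-comm f = trans (double f) (trans (∑-comm f) (sym (double (λ j i → f i j))))
  where
  double : ∀ {m n} (f : Fin m → Fin n → ℚ) →
    ΣF (λ i → ΣF (λ j → f i j)) ≡ sum (λ i → sum (λ j → f i j))
  double f = trans (ΣF≡sum (λ i → ΣF (f i))) (sum-cong-≗ (λ i → ΣF≡sum (f i)))

ΣF-remove : ∀ {n} (f : Fin (suc n) → ℚ) i → ΣF f ≡ f i + ΣF (f ∘ punchIn i)
ΣF-remove f i =
  trans (ΣF≡sum f) (trans (sum-remove {i = i} f) (cong (f i +_) (sym (ΣF≡sum (f ∘ punchIn i)))))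

ΣF-insertAt : ∀ {n} (c : Fin n → ℚ) i a (g : Fin (suc n) → ℚ) →
  ΣF (λ t → insertAt c i a t * g t) ≡ a * g i + ΣF (λ t → c t * g (punchIn i t))
ΣF-insertAt c i a g = trans (ΣF-remove (λ t → insertAt c i a t * g t) i)
  (cong₂ _+_ (cong (_* g i) (insertAt-lookup c i a))
    (ΣF-cong (λ t → cong (_* g (punchIn i t)) (insertAt-punchIn c i a t))))

-- Gaussian elimination on the first column: if it vanishes, one vector is left out; otherwise a
-- pivot vector clears it from all the others. Either way one vector and one column fewer remain.
dependent : ∀ k (M : Fin (suc k) → Fin k → ℚ) →
  Σ (Fin (suc k) → ℚ) λ c →
    (∃ λ t → c t ≢ 0ℚ) × (∀ s → ΣF (λ t → c t * M t s) ≡ 0ℚ)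
dependent zero    M = (λ _ → 1ℚ) , (F.zero , λ ()) , λ ()
dependent (suc k) M with Fin.any? (λ t → ¬? (M t F.zero ≟ 0ℚ))
... | no allZero =
  insertAt c i 0ℚ , (punchIn i t , c≢0 ∘ trans (sym (insertAt-punchIn c i 0ℚ t))) , eqs
  where
  i = F.zero
  IH = dependent k (λ t s → M (punchIn i t) (F.suc s))
  c = proj₁ IH
  t = proj₁ (proj₁ (proj₂ IH))
  c≢0 = proj₂ (proj₁ (proj₂ IH))
  col0 : ∀ t → M t F.zero ≡ 0ℚ
  col0 t = decidable-stable (M t F.zero ≟ 0ℚ) (λ ne → allZero (t , ne))
  drop : ∀ s → ΣF (λ t → insertAt c i 0ℚ t * M t s) ≡ ΣF (λ t → c t * M (punchIn i t) s)
  drop s = trans (ΣF-insertAt c i 0ℚ (λ t → M t s))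
    (trans (cong (_+ S) (*-zeroˡ (M i s))) (+-identityˡ S))
    where S = ΣF (λ t → c t * M (punchIn i t) s)
  eqs : ∀ s → ΣF (λ t → insertAt c i 0ℚ t * M t s) ≡ 0ℚ
  eqs F.zero    = trans (drop F.zero)
    (ΣF-zero (λ t → trans (cong (c t *_) (col0 (punchIn i t))) (*-zeroʳ (c t))))
  eqs (F.suc s) = trans (drop (F.suc s)) (proj₂ (proj₂ IH) s)
... | yes (i , pivot≢0) =
  insertAt c i a , (punchIn i t , c≢0 ∘ trans (sym (insertAt-punchIn c i a t))) , eqs
  where
  instance _ = ≢-nonZero pivot≢0
  inv = 1/ M i F.zero
  f : Fin (suc k) → ℚ
  f t = M (punchIn i t) F.zero * inv
  IH = dependent k (λ t s → M (punchIn i t) (F.suc s) + - (f t * M i (F.suc s)))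
  c = proj₁ IH
  t = proj₁ (proj₁ (proj₂ IH))
  c≢0 = proj₂ (proj₁ (proj₂ IH))
  -- Undoes the elimination: the multiples of the pivot vector that were subtracted from the others
  -- are collected in its own coefficient.
  a = - ΣF (λ t → c t * f t)
  eliminate : ∀ s → ΣF (λ t → insertAt c i a t * M t s)
    ≡ ΣF (λ t → c t * (M (punchIn i t) s + - (f t * M i s)))
  eliminate s = trans (ΣF-insertAt c i a (λ t → M t s)) (trans
    (cong (_+ S) (trans
      (solve 2 (λ x m → :- x :* m := (:- m) :* x) refl (ΣF (λ t → c t * f t)) (M i s))
      (*-distribˡ-ΣF (- M i s) (λ t → c t * f t))))
    (trans (sym (ΣF-distrib-+ (λ t → - M i s * (c t * f t)) (λ t → c t * M (punchIn i t) s))) (ΣF-cong (λ t →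
      solve 4 (λ m c f n → (:- m) :* (c :* f) :+ c :* n := c :* (n :+ :- (f :* m)))
        refl (M i s) (c t) (f t) (M (punchIn i t) s)))))
    where S = ΣF (λ t → c t * M (punchIn i t) s)
  eqs : ∀ s → ΣF (λ t → insertAt c i a t * M t s) ≡ 0ℚ
  eqs F.zero = trans (eliminate F.zero) (ΣF-zero (λ t → trans
    (cong (c t *_) (trans
      (cong (λ x → M (punchIn i t) F.zero + - x)
        (trans (*-assoc (M (punchIn i t) F.zero) inv (M i F.zero))
          (cong (M (punchIn i t) F.zero *_) (trans (*-comm inv _) (*-inverseʳ (M i F.zero))))))
      (solve 1 (λ m → m :+ :- (m :* con 1ℚ) := con 0ℚ) refl (M (punchIn i t) F.zero))))
    (*-zeroʳ (c t))))
  eqs (F.suc s) = trans (eliminate (F.suc s)) (proj₂ (proj₂ IH) s)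

-- Bounds on the nullity through chosen coordinates

InKernel-cong : ∀ {n} {A B : Matrix n} → (∀ i j → A i j ≡ B i j) →
  ∀ {x} → InKernel A x → InKernel B x
InKernel-cong A≗B {x} ker i = trans (ΣF-cong (λ j → cong (_* x j) (sym (A≗B i j)))) (ker i)

InKernel-combination : ∀ {n k} (A : Matrix n) (v : Fin k → Fin n → ℚ) (c : Fin k → ℚ) →
  (∀ t → InKernel A (v t)) → InKernel A (λ j → ΣF (λ t → c t * v t j))
InKernel-combination A v c ker i =
  trans (ΣF-cong (λ j → *-distribˡ-ΣF (A i j) (λ t → c t * v t j)))
  (trans (ΣF-comm (λ j t → A i j * (c t * v t j)))
  (ΣF-zero (λ t → trans
    (ΣF-cong (λ j → solve 3 (λ a c v → a :* (c :* v) := c :* (a :* v)) refl (A i j) (c t) (v t j)))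
    (trans (sym (*-distribˡ-ΣF (c t) (λ j → A i j * v t j)))
      (trans (cong (c t *_) (ker t i)) (*-zeroʳ (c t)))))))

-- Among `suc k` kernel vectors the `k` chosen coordinates satisfy a nontrivial relation; the
-- combination it describes vanishes at these coordinates, hence everywhere, against independence.
¬NullityAtLeast-coordinates : ∀ {n k} (A : Matrix n) (idx : Fin k → Fin n) →
  (∀ x → InKernel A x → (∀ s → x (idx s) ≡ 0ℚ) → ∀ j → x j ≡ 0ℚ) →
  ¬ NullityAtLeast A (suc k)
¬NullityAtLeast-coordinates {k = k} A idx determined (v , ker , indep)
  with c , (t , c≢0) , eqs ← dependent k (λ t s → v t (idx s)) =
  c≢0 (indep c (determined _ (InKernel-combination A v c ker) eqs) t)

*-zero-cancelʳ : ∀ a {b} → b ≢ 0ℚ → a * b ≡ 0ℚ → a ≡ 0ℚ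
*-zero-cancelʳ a {b} b≢0 ab≡0 = trans
  (solve 1 (λ a → a := a :* con 1ℚ) refl a)
  (trans (cong (a *_) (sym (*-inverseʳ b)))
  (trans (sym (*-assoc a b (1/ b))) (trans (cong (_* 1/ b) ab≡0) (*-zeroˡ (1/ b)))))
  where instance _ = ≢-nonZero b≢0

-- Reading a vanishing combination at `idx s` leaves only the term of `c s`.
LinIndep-diagonal : ∀ {n k} (v : Fin k → Fin n → ℚ) (idx : Fin k → Fin n) →
  (∀ t → v t (idx t) ≢ 0ℚ) → (∀ t s → t ≢ s → v t (idx s) ≡ 0ℚ) → LinIndep v
LinIndep-diagonal {k = suc k} v idx diag off c comb s = *-zero-cancelʳ (c s) (diag s)
  (trans (sym (+-identityʳ _)) (trans
    (cong (c s * v s (idx s) +_) (sym (ΣF-zero (λ t → trans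
      (cong (c (punchIn s t) *_) (off (punchIn s t) s (Fin.punchInᵢ≢i s t)))
      (*-zeroʳ (c (punchIn s t)))))))
    (trans (sym (ΣF-remove (λ t → c t * v t (idx s)) s)) (comb (idx s)))))

NullityAtLeast-cong : ∀ {n} {A B : Matrix n} → (∀ i j → A i j ≡ B i j) →
  ∀ {k} → NullityAtLeast A k → NullityAtLeast B k
NullityAtLeast-cong A≗B (v , ker , indep) =
  v , (λ t → InKernel-cong A≗B (ker t)) , indep

-- Row sums indexed by natural numbers

-- Extension by zero lets neighbours be addressed by arithmetic without bounds, and gives the last
-- row the same shape as the others: its missing successor has value 0.
ext : ∀ {n} → (Fin n → ℚ) → ℕ → ℚ
ext {zero}  x c       = 0ℚ
ext {suc n} x zero    = x F.zero
ext {suc n} x (suc c) = ext (x ∘ F.suc) c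

ext-toℕ : ∀ {n} (x : Fin n → ℚ) j → ext x (toℕ j) ≡ x j
ext-toℕ x F.zero    = refl
ext-toℕ x (F.suc j) = ext-toℕ (x ∘ F.suc) j

ext-≥ : ∀ {n} (x : Fin n → ℚ) {c} → n ≤ c → ext x c ≡ 0ℚ
ext-≥ {zero}  x n≤c       = refl
ext-≥ {suc n} x (s≤s n≤c) = ext-≥ (x ∘ F.suc) n≤c

ext-< : ∀ {n} (f : ℕ → ℚ) {c} → c < n → ext {n} (f ∘ toℕ) c ≡ f c
ext-< {suc n} f {zero}  c<n       = refl
ext-< {suc n} f {suc c} (s≤s c<n) = ext-< (f ∘ suc) c<n

-- One row of a weighted adjacency matrix applied to `x`: `e` selects the neighbours and `f` carries
-- the signs.
Σif : ∀ {n} → (ℕ → Bool) → (ℕ → ℚ) → (Fin n → ℚ) → ℚ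
Σif e f x = ΣF (λ j → (if e (toℕ j) then f (toℕ j) else 0ℚ) * x j)

Σif-cong : ∀ {n} {e e′ : ℕ → Bool} (f : ℕ → ℚ) (x : Fin n → ℚ) →
  (∀ b → e b ≡ e′ b) → Σif e f x ≡ Σif e′ f x
Σif-cong f x e≗e′ = ΣF-cong (λ j →
  cong (λ t → (if t then f (toℕ j) else 0ℚ) * x j) (e≗e′ (toℕ j)))

Σif-none : ∀ {n} (f : ℕ → ℚ) (x : Fin n → ℚ) → Σif (λ _ → false) f x ≡ 0ℚ
Σif-none f x = ΣF-zero (λ j → *-zeroˡ (x j))

Σif-≡ᵇ : ∀ {n} c (f : ℕ → ℚ) (x : Fin n → ℚ) → Σif (c ≡ᵇ_) f x ≡ f c * ext x c
Σif-≡ᵇ {zero}  c       f x = sym (*-zeroʳ (f c))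
Σif-≡ᵇ {suc n} zero    f x =
  trans (cong (f 0 * x F.zero +_) (Σif-none (f ∘ suc) (x ∘ F.suc))) (+-identityʳ _)
Σif-≡ᵇ {suc n} (suc c) f x =
  trans (cong₂ _+_ (*-zeroˡ (x F.zero)) (Σif-≡ᵇ c (f ∘ suc) (x ∘ F.suc))) (+-identityˡ _)

==≡≡ᵇ : ∀ a b → (a == b) ≡ (a ≡ᵇ b)
==≡≡ᵇ a b = isYes≗does (a ℕ.≟ b)

==⇒≡ : ∀ a b → T (a == b) → a ≡ b
==⇒≡ a b = toWitness {a? = a ℕ.≟ b}

==-comm : ∀ a b → (a == b) ≡ (b == a)
==-comm a b = trans (==≡≡ᵇ a b) (trans (go a b) (sym (==≡≡ᵇ b a)))
  where
  go : ∀ a b → (a ≡ᵇ b) ≡ (b ≡ᵇ a)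
  go zero    zero    = refl
  go zero    (suc b) = refl
  go (suc a) zero    = refl
  go (suc a) (suc b) = go a b

==-suc : ∀ a b → (suc a == suc b) ≡ (a == b)
==-suc a b = trans (==≡≡ᵇ (suc a) (suc b)) (sym (==≡≡ᵇ a b))

Σif-== : ∀ {n} c (f : ℕ → ℚ) (x : Fin n → ℚ) → Σif (c ==_) f x ≡ f c * ext x c
Σif-== c f x = trans (Σif-cong f x (==≡≡ᵇ c)) (Σif-≡ᵇ c f x)

-- A disjunction counts an edge once, the sum of the two parts counts a common edge twice;
-- disjointness is therefore what splits a row into path and chord contributions.
Σif-∨ : ∀ {n} (e e′ : ℕ → Bool) (f : ℕ → ℚ) (x : Fin n → ℚ) →
  (∀ b → T (e b) → T (e′ b) → ⊥) →
  Σif (λ b → e b ∨ e′ b) f x ≡ Σif e f x + Σif e′ f x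
Σif-∨ e e′ f x disjoint = trans
  (ΣF-cong (λ j → split (e (toℕ j)) (e′ (toℕ j)) (f (toℕ j)) (x j) (disjoint (toℕ j))))
  (ΣF-distrib-+ (λ j → (if e (toℕ j) then f (toℕ j) else 0ℚ) * x j)
    (λ j → (if e′ (toℕ j) then f (toℕ j) else 0ℚ) * x j))
  where
  split : ∀ s t u v → (T s → T t → ⊥) →
    (if s ∨ t then u else 0ℚ) * v ≡ (if s then u else 0ℚ) * v + (if t then u else 0ℚ) * v
  split true  true  u v d = contradiction _ (d _)
  split true  false u v d = solve 2 (λ u v → u :* v := u :* v :+ con 0ℚ :* v) refl u v
  split false t     u v d = solve 2 (λ u v → u :* v := con 0ℚ :* v :+ u :* v) refl (if t then u else 0ℚ) v

Σif-∧ : ∀ {n} t (e : ℕ → Bool) (f : ℕ → ℚ) (x : Fin n → ℚ) →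
  Σif (λ b → t ∧ e b) f x ≡ (if t then Σif e f x else 0ℚ)
Σif-∧ true  e f x = refl
Σif-∧ false e f x = Σif-none f x

T-isPair : ∀ {a b} c d → T (isPair a b c d) → (a ≡ c × b ≡ d) ⊎ (a ≡ d × b ≡ c)
T-isPair {a} {b} c d t with to (T-∨ {(a == c) ∧ (b == d)}) t
... | inj₁ t′ with u , v ← to (T-∧ {a == c}) t′ = inj₁ (==⇒≡ a c u , ==⇒≡ b d v)
... | inj₂ t′ with u , v ← to (T-∧ {a == d}) t′ = inj₂ (==⇒≡ a d u , ==⇒≡ b c v)

pairRow : (ℕ → ℚ) → ℕ → ℕ → (ℕ → ℚ) → ℕ → ℚ
pairRow w c d z a = (if a == c then w d * z d else 0ℚ) + (if a == d then w c * z c else 0ℚ)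

Σif-isPair : ∀ {n} (w : ℕ → ℚ) (x : Fin n → ℚ) {c d} → c ≢ d → ∀ a →
  Σif (λ b → isPair a b c d) w x ≡ pairRow w c d (ext x) a
Σif-isPair w x {c} {d} c≢d a = trans
  (Σif-∨ (λ b → (a == c) ∧ (b == d)) (λ b → (a == d) ∧ (b == c)) w x
    (λ b t u → c≢d (trans (sym (==⇒≡ a c (proj₁ (to (T-∧ {a == c}) t))))
                          (==⇒≡ a d (proj₁ (to (T-∧ {a == d}) u))))))
  (cong₂ _+_ (half c d) (half d c))
  where
  half : ∀ c d → Σif (λ b → (a == c) ∧ (b == d)) w x ≡ (if a == c then w d * ext x d else 0ℚ)
  half c d = trans (Σif-∧ (a == c) (_== d) w x)
    (cong (λ s → if a == c then s else 0ℚ)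
      (trans (Σif-cong w x (λ b → ==-comm b d)) (Σif-== d w x)))

-- Signs and switching

IsUnit : ℚ → Set
IsUnit s = s ≡ 1ℚ ⊎ s ≡ - 1ℚ

sgn-unit : ∀ s → IsUnit (sgn s)
sgn-unit pos = inj₁ refl
sgn-unit neg = inj₂ refl

unit-* : ∀ {s t} → IsUnit s → IsUnit t → IsUnit (s * t)
unit-* (inj₁ refl) (inj₁ refl) = inj₁ refl
unit-* (inj₁ refl) (inj₂ refl) = inj₂ refl
unit-* (inj₂ refl) (inj₁ refl) = inj₂ refl
unit-* (inj₂ refl) (inj₂ refl) = inj₁ refl

unit-square : ∀ {s} → IsUnit s → s * s ≡ 1ℚ
unit-square (inj₁ refl) = refl
unit-square (inj₂ refl) = refl

unit-cancelˡ : ∀ {s} → IsUnit s → ∀ x → s * (s * x) ≡ x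
unit-cancelˡ {s} u x = trans (solve 2 (λ s x → s :* (s :* x) := (s :* s) :* x) refl s x)
  (trans (cong (_* x) (unit-square u)) (*-identityˡ x))

unit-cancel-zero : ∀ {s} → IsUnit s → ∀ {x} → s * x ≡ 0ℚ → x ≡ 0ℚ
unit-cancel-zero {s} u {x} e =
  trans (sym (unit-cancelˡ u x)) (trans (cong (s *_) e) (*-zeroʳ s))

pathSign : (ℕ → ℕ → Sign) → ℕ → ℚ
pathSign τ zero    = 1ℚ
pathSign τ (suc i) = pathSign τ i * sgn (τ i (suc i))

pathSign-unit : ∀ τ i → IsUnit (pathSign τ i)
pathSign-unit τ zero    = inj₁ refl
pathSign-unit τ (suc i) = unit-* (pathSign-unit τ i) (sgn-unit (τ i (suc i)))

-- The sign of the cycle formed by the path from c to d and the edge {c, d}: the signs of the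
-- path edges before c occur twice and cancel.
chordSign : (ℕ → ℕ → Sign) → ℕ → ℕ → ℚ
chordSign τ c d = sgn (τ c d) * (pathSign τ c * pathSign τ d)

chordSign-unit : ∀ τ c d → IsUnit (chordSign τ c d)
chordSign-unit τ c d = unit-* (sgn-unit (τ c d)) (unit-* (pathSign-unit τ c) (pathSign-unit τ d))

-- Rows of the all-positive path that is infinite to the right; on a finite path the extension by
-- zero cuts it off.
pathRow : (ℕ → ℚ) → ℕ → ℚ
pathRow y zero    = y 1
pathRow y (suc a) = y (suc (suc a)) + y a

chordRow : ℚ → ℕ → ℕ → (ℕ → ℚ) → ℕ → ℚ
chordRow γ c d y a = (if a == c then γ * y d else 0ℚ) + (if a == d then γ * y c else 0ℚ)

pathAnd : (ℕ → ℕ → Bool) → ℕ → ℕ → Bool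
pathAnd extra a b = (suc a == b) ∨ (suc b == a) ∨ extra a b

signedMatrix : (ℕ → ℕ → Bool) → (ℕ → ℕ → Sign) → ∀ n → Matrix n
signedMatrix e τ n i j = if e (toℕ i) (toℕ j) then sgn (τ (toℕ i) (toℕ j)) else 0ℚ

-- Switching by the signs of the initial segments turns every path edge positive.
switch : (ℕ → ℕ → Sign) → ∀ {n} → (Fin n → ℚ) → ℕ → ℚ
switch τ x c = pathSign τ c * ext x c

OffPath : (ℕ → ℕ → Bool) → Set
OffPath extra = ∀ a b → T (extra a b) → suc a ≢ b × suc b ≢ a

if-zero : ∀ (t : Bool) {u v : ℚ} → (T t → u ≡ v) → (if t then u else 0ℚ) ≡ (if t then v else 0ℚ)
if-zero true  e = e _
if-zero false e = refl

*-if : ∀ s t u → s * (if t then u else 0ℚ) ≡ (if t then s * u else 0ℚ)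
*-if s true  u = refl
*-if s false u = *-zeroʳ s

module Rows (τ : ℕ → ℕ → Sign) (τ-sym : Symmetric τ) where

  private
    D = pathSign τ

  switched-path : ∀ {n} (x : Fin n → ℚ) a →
    D a * (Σif (λ b → suc a == b) (sgn ∘ τ a) x + Σif (λ b → suc b == a) (sgn ∘ τ a) x)
      ≡ pathRow (switch τ x) a
  switched-path x a = trans
    (cong (λ s → D a * (s + Σif (λ b → suc b == a) (sgn ∘ τ a) x)) (Σif-== (suc a) (sgn ∘ τ a) x))
    (lower a)
    where
    lower : ∀ a →
      D a * (sgn (τ a (suc a)) * ext x (suc a) + Σif (λ b → suc b == a) (sgn ∘ τ a) x)
        ≡ pathRow (switch τ x) a
    lower zero = trans
      (cong (λ s → D 0 * (sgn (τ 0 1) * ext x 1 + s)) (Σif-none (sgn ∘ τ 0) x))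
      (solve 3 (λ d s z → d :* (s :* z :+ con 0ℚ) := d :* s :* z) refl (D 0) (sgn (τ 0 1)) (ext x 1))
    lower (suc a) = trans
      (cong (λ s → d * t * (t′ * z″ + s)) (trans
        (trans (Σif-cong (sgn ∘ τ (suc a)) x (λ b → trans (==-suc b a) (==-comm b a))) (Σif-== a (sgn ∘ τ (suc a)) x))
        (cong (λ s → sgn s * z) (τ-sym (suc a) a))))
      -- The sign of the edge to the predecessor occurs twice, once in `D (suc a)` and once as
      -- matrix entry, so it cancels; the sign of the edge to the successor completes `pathSign`
      -- there.
      (trans (solve 5 (λ d t t′ z″ z → d :* t :* (t′ :* z″ :+ t :* z) :=
                d :* t :* t′ :* z″ :+ t :* t :* (d :* z)) refl d t t′ z″ z)
        (cong (d * t * t′ * z″ +_) (trans (cong (_* (d * z)) (unit-square (sgn-unit (τ a (suc a)))))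
          (*-identityˡ (d * z)))))
      where
      d = D a
      t = sgn (τ a (suc a))
      t′ = sgn (τ (suc a) (suc (suc a)))
      z″ = ext x (suc (suc a))
      z = ext x a

  switched-isPair : ∀ {n} (x : Fin n → ℚ) {c d} → c ≢ d → ∀ a →
    D a * Σif (λ b → isPair a b c d) (sgn ∘ τ a) x
      ≡ chordRow (chordSign τ c d) c d (switch τ x) a
  switched-isPair x {c} {d} c≢d a = trans
    (cong (D a *_) (Σif-isPair (sgn ∘ τ a) x c≢d a))
    (trans (solve 3 (λ s u v → s :* (u :+ v) := s :* u :+ s :* v) refl (D a)
      (if a == c then sgn (τ a d) * z d else 0ℚ) (if a == d then sgn (τ a c) * z c else 0ℚ))
    (cong₂ _+_ (half c d refl) (half d c (trans
      (cong (_* (D d * D c)) (cong sgn (τ-sym d c)))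
      (cong (sgn (τ c d) *_) (*-comm (D d) (D c)))))))
    where
    z = ext x
    -- The sign is passed through an equation so that the use with `c` and `d` exchanged can, by
    -- symmetry, name the same `chordSign τ c d`.
    half : ∀ c d {γ} → chordSign τ c d ≡ γ →
      D a * (if a == c then sgn (τ a d) * z d else 0ℚ) ≡ (if a == c then γ * switch τ x d else 0ℚ)
    half c d refl = trans (*-if (D a) (a == c) (sgn (τ a d) * z d)) (if-zero (a == c) (λ t → at (==⇒≡ a c t)))
      where
      at : a ≡ c → D a * (sgn (τ a d) * z d) ≡ chordSign τ c d * (D d * z d)
      -- The square of `D d` is inserted to turn the plain value at `d` into the switched one.
      at refl = sym (trans
        (solve 4 (λ s a d z → s :* (a :* d) :* (d :* z) := d :* d :* (a :* (s :* z))) refl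
          (sgn (τ a d)) (D a) (D d) (z d))
        (trans (cong (_* (D a * (sgn (τ a d) * z d))) (unit-square (pathSign-unit τ d))) (*-identityˡ _)))

  switched-row : ∀ {n} extra → OffPath extra → (x : Fin n → ℚ) → ∀ a →
    D a * Σif (pathAnd extra a) (sgn ∘ τ a) x
      ≡ pathRow (switch τ x) a + D a * Σif (extra a) (sgn ∘ τ a) x
  switched-row extra off x a = trans
    (cong (D a *_) (trans
      (Σif-∨ (λ b → suc a == b) (λ b → (suc b == a) ∨ extra a b) f x up)
      (cong (U +_) (Σif-∨ (λ b → suc b == a) (extra a) f x down))))
    (trans (solve 4 (λ d u v w → d :* (u :+ (v :+ w)) := d :* (u :+ v) :+ d :* w) refl (D a) U V W)
      (cong (_+ D a * W) (switched-path x a)))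
    where
    f = sgn ∘ τ a
    U = Σif (λ b → suc a == b) f x
    V = Σif (λ b → suc b == a) f x
    W = Σif (extra a) f x
    down : ∀ b → T (suc b == a) → T (extra a b) → ⊥
    down b t u = proj₂ (off a b u) (==⇒≡ (suc b) a t)
    up : ∀ b → T (suc a == b) → T ((suc b == a) ∨ extra a b) → ⊥
    up b t u with to (T-∨ {suc b == a}) u
    ... | inj₁ v = ℕ.<-asym (ℕ.≤-reflexive (==⇒≡ (suc a) b t)) (ℕ.≤-reflexive (==⇒≡ (suc b) a v))
    ... | inj₂ v = proj₁ (off a b v) (==⇒≡ (suc a) b t)

  kernel⇒rows : ∀ {n} e (x : Fin n → ℚ) → InKernel (signedMatrix e τ n) x →
    ∀ a → a < n → D a * Σif (e a) (sgn ∘ τ a) x ≡ 0ℚ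
  kernel⇒rows e x ker a a<n = trans
    (cong (D a *_) (subst (λ a → Σif (e a) (sgn ∘ τ a) x ≡ 0ℚ) (Fin.toℕ-fromℕ< a<n) (ker (fromℕ< a<n))))
    (*-zeroʳ (D a))

  rows⇒kernel : ∀ {n} e (x : Fin n → ℚ) →
    (∀ a → a < n → D a * Σif (e a) (sgn ∘ τ a) x ≡ 0ℚ) → InKernel (signedMatrix e τ n) x
  rows⇒kernel e x rows i =
    unit-cancel-zero (pathSign-unit τ (toℕ i)) (rows (toℕ i) (Fin.toℕ<n i))

-- The perturbed recurrence and its closing conditions

==-refl : ∀ a → (a == a) ≡ true
==-refl a = trans (isYes≗does (a ℕ.≟ a)) (dec-true (a ℕ.≟ a) refl)

≢⇒== : ∀ {a b} → a ≢ b → (a == b) ≡ false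
≢⇒== {a} {b} a≢b = trans (isYes≗does (a ℕ.≟ b)) (dec-false (a ℕ.≟ b) a≢b)

alt : ℕ → ℚ → ℚ → ℚ
alt zero          u v = u
alt (suc zero)    u v = v
alt (suc (suc i)) u v = - alt i u v

alt-segment : ∀ (z : ℕ → ℚ) n → (∀ j → j < n → z (suc (suc j)) ≡ - z j) →
  ∀ j → j ≤ suc n → z j ≡ alt j (z 0) (z 1)
alt-segment z n step zero          j≤       = refl
alt-segment z n step (suc zero)    j≤       = refl
alt-segment z n step (suc (suc j)) (s≤s j<n) =
  trans (step j j<n) (cong -_ (alt-segment z n step j (ℕ.m≤n⇒m≤1+n (ℕ.<⇒≤ j<n))))

driven : (ℕ → ℚ) → ℚ → ℚ → ℕ → ℚ
driven src u v zero          = u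
driven src u v (suc zero)    = v
driven src u v (suc (suc i)) = - (driven src u v i + src i)

driven-zero : ∀ (src y : ℕ → ℚ) k → (∀ i → i < k → y (suc (suc i)) ≡ - (y i + src i)) →
  (∀ i → src i ≡ 0ℚ) → y 0 ≡ 0ℚ → y 1 ≡ 0ℚ → ∀ j → j ≤ suc k → y j ≡ 0ℚ
driven-zero src y k step src≡0 y₀ y₁ zero          j≤       = y₀
driven-zero src y k step src≡0 y₀ y₁ (suc zero)    j≤       = y₁
driven-zero src y k step src≡0 y₀ y₁ (suc (suc i)) (s≤s i<k) =
  trans (step i i<k) (cong -_ (cong₂ _+_
    (driven-zero src y k step src≡0 y₀ y₁ i (ℕ.m≤n⇒m≤1+n (ℕ.<⇒≤ i<k))) (src≡0 i)))

≡-⇒+≡0 : ∀ {x y s} → x ≡ - (y + s) → (x + y) + s ≡ 0ℚ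
≡-⇒+≡0 {_} {y} {s} refl = solve 2 (λ y s → (:- (y :+ s) :+ y) :+ s := con 0ℚ) refl y s

+≡0⇒≡- : ∀ {x y s} → (x + y) + s ≡ 0ℚ → x ≡ - (y + s)
+≡0⇒≡- {x} {y} {s} e = trans
  (solve 3 (λ x y s → x := ((x :+ y) :+ s) :+ (:- (y :+ s))) refl x y s)
  (trans (cong (_+ - (y + s)) e) (+-identityˡ _))

-- m + 2, L + 1 and n + 2 are the paper's p, l and q: the cycles close up at
-- the chords {0, P} and {r, suc k}, and the path runs from P to r.
module Model (m L n : ℕ) (1≤m : 1 ≤ m) (1≤n : 1 ≤ n) (α β : ℚ) where

  P r k : ℕ
  P = suc m
  r = suc (L ℕ.+ m)
  k = n ℕ.+ r

  private
    r≤k : r ≤ k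
    r≤k = ℕ.m≤n+m r n
    P≤r : P ≤ r
    P≤r = s≤s (ℕ.m≤n+m m L)

  modelRow : (ℕ → ℚ) → ℕ → ℚ
  modelRow y a = pathRow y a + (chordRow α 0 P y a + chordRow β r (suc k) y a)

  -- The chord terms of row `suc i`. The value `b` is an argument of its own, because row `r` comes
  -- before the last vertex has been computed.
  source : ℚ → ℚ → ℕ → ℚ
  source u b i = (if suc i == P then α * u else 0ℚ) + (if suc i == r then b else 0ℚ)

  -- The `k` inner rows each produce the next value from earlier ones. Row 0 has no predecessor and
  -- the last row no successor, so these two remain as constraints.
  record Balanced (y : ℕ → ℚ) : Set where
    field
      first : y 1 + α * y P ≡ 0ℚ
      inner : ∀ i → i < k → y (suc (suc i)) ≡ - (y i + source (y 0) (β * y (suc k)) i)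
      final : y k + β * y r ≡ 0ℚ

  row-first : ∀ y → modelRow y 0 ≡ y 1 + α * y P
  row-first y = solve 2 (λ a b → a :+ ((b :+ con 0ℚ) :+ (con 0ℚ :+ con 0ℚ)) := a :+ b) refl (y 1) (α * y P)

  row-inner : ∀ y i → i < k →
    modelRow y (suc i) ≡ (y (suc (suc i)) + y i) + source (y 0) (β * y (suc k)) i
  row-inner y i i<k = cong (pathRow y (suc i) +_) (cong₂ _+_ (+-identityˡ atP)
    (trans (cong (λ t → atR + (if t then β * y r else 0ℚ)) (≢⇒== (ℕ.<⇒≢ (s≤s i<k))))
      (+-identityʳ atR)))
    where
    atP = if suc i == P then α * y 0 else 0ℚ
    atR = if suc i == r then β * y (suc k) else 0ℚ

  row-final : ∀ y → y (suc (suc k)) ≡ 0ℚ → modelRow y (suc k) ≡ y k + β * y r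
  row-final y beyond
    rewrite ≢⇒== {suc k} {P} (λ e → ℕ.<⇒≢ (s≤s (ℕ.≤-trans P≤r r≤k)) (sym e))
          | ≢⇒== {suc k} {r} (λ e → ℕ.<⇒≢ (s≤s r≤k) (sym e))
          | ==-refl (suc k) | beyond =
    solve 2 (λ a b → con 0ℚ :+ a :+ ((con 0ℚ :+ con 0ℚ) :+ (con 0ℚ :+ b)) := a :+ b) refl (y k) (β * y r)

  rows⇒balanced : ∀ y → y (suc (suc k)) ≡ 0ℚ → (∀ a → a < suc (suc k) → modelRow y a ≡ 0ℚ) → Balanced y
  rows⇒balanced y beyond rows = record
    { first = trans (sym (row-first y)) (rows 0 (s≤s z≤n))
    ; inner = λ i i<k → +≡0⇒≡- (trans (sym (row-inner y i i<k)) (rows (suc i) (s≤s (ℕ.m≤n⇒m≤1+n i<k))))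
    ; final = trans (sym (row-final y beyond)) (rows (suc k) ℕ.≤-refl)
    }

  balanced⇒rows : ∀ y → y (suc (suc k)) ≡ 0ℚ → Balanced y → ∀ a → a < suc (suc k) → modelRow y a ≡ 0ℚ
  balanced⇒rows y beyond bal zero    a< = trans (row-first y) (Balanced.first bal)
  balanced⇒rows y beyond bal (suc i) (s≤s (s≤s i≤k)) with ℕ.m≤n⇒m<n∨m≡n i≤k
  ... | inj₁ i<k  = trans (row-inner y i i<k) (≡-⇒+≡0 (Balanced.inner bal i i<k))
  ... | inj₂ refl = trans (row-final y beyond) (Balanced.final bal)

  source-off : ∀ u b i → suc i ≢ P → suc i ≢ r → source u b i ≡ 0ℚ
  source-off u b i ≢P ≢r rewrite ≢⇒== ≢P | ≢⇒== ≢r = refl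

  -- The values entering and leaving the path as functions of the free coordinates:
  -- (g , w) at its first vertex and (z , w′) at its last one, z excluding C_q.
  module _ (u v : ℚ) where
    w g z w′ : ℚ
    w  = alt P u v
    g  = alt m u v + α * u
    z  = alt L g w
    w′ = alt (suc L) g w

  -- What remains of the whole system in three unknowns: `closeP` is row 0, `closeQ` is the last
  -- row, and `chordQ` says that the guess `b` agrees with the last value.
  record Closes (u v b : ℚ) : Set where
    field
      closeP : v + α * w u v ≡ 0ℚ
      chordQ : b ≡ β * alt (suc (suc n)) (z u v + b) (w′ u v)
      closeQ : alt (suc n) (z u v + b) (w′ u v) + β * w′ u v ≡ 0ℚ

  -- Stated for an arbitrary `b`, since it serves twice: for a given kernel vector, and for the
  -- vector built by recurrence, where the meaning of `b` is only established afterwards.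
  module Solve (y : ℕ → ℚ) (b : ℚ)
    (step : ∀ i → i < k → y (suc (suc i)) ≡ - (y i + source (y 0) b i)) where

    free : ∀ i → i < k → suc i ≢ P → suc i ≢ r → y (suc (suc i)) ≡ - y i
    free i i<k ≢P ≢r = trans (step i i<k)
      (cong -_ (trans (cong (y i +_) (source-off (y 0) b i ≢P ≢r)) (+-identityʳ _)))

    on-P : ∀ j → j ≤ P → y j ≡ alt j (y 0) (y 1)
    on-P = alt-segment y m (λ j j<m → free j (ℕ.<-≤-trans (ℕ.m≤n⇒m≤1+n j<m) (ℕ.≤-trans P≤r r≤k))
      (ℕ.<⇒≢ (s≤s j<m)) (ℕ.<⇒≢ (ℕ.<-≤-trans (s≤s j<m) P≤r)))

    -- Entry 0 is fictitious: it absorbs the chord at `P`, so the row of `P` reads like any other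
    -- row of the path.
    path : ℕ → ℚ
    path zero    = y m + α * y 0
    path (suc j) = y (suc (j ℕ.+ m))

    on-path : ∀ j → j ≤ suc L → path j ≡ alt j (g (y 0) (y 1)) (w (y 0) (y 1))
    on-path j j≤ = trans (alt-segment path L path-step j j≤)
      (cong₂ (alt j) (cong (_+ α * y 0) (on-P m (ℕ.n≤1+n m))) (on-P P ℕ.≤-refl))
      where
      path-step : ∀ j → j < L → path (suc (suc j)) ≡ - path j
      path-step zero    0<L = trans (step m (ℕ.<-≤-trans ℕ.≤-refl (ℕ.≤-trans P≤r r≤k))) (cong (λ s → - (y m + s))
        (trans (cong₂ (λ s t → (if s then α * y 0 else 0ℚ) + (if t then b else 0ℚ))
          (==-refl P) (≢⇒== (ℕ.<⇒≢ (s≤s (ℕ.+-monoˡ-≤ m 0<L))))) (+-identityʳ _)))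
      path-step (suc j) j<L = free (suc (j ℕ.+ m))
        (ℕ.<-≤-trans (s≤s (ℕ.+-monoˡ-≤ m (ℕ.<⇒≤ j<L))) r≤k)
        (λ e → ℕ.<⇒≢ (s≤s (s≤s (ℕ.m≤n+m m j))) (sym e))
        (ℕ.<⇒≢ (s≤s (ℕ.+-monoˡ-≤ m j<L)))

    -- The same device at `r`. Starting from `path L` instead of a value of `y` covers `L = 0`,
    -- where the chord of the first cycle enters this row as well.
    tail : ℕ → ℚ
    tail zero    = path L + b
    tail (suc j) = y (j ℕ.+ r)

    -- The test `r == P` succeeds exactly when the two cycles share a vertex; then the extra term is
    -- the one already contained in `path 0`.
    path-last : ∀ l → (r ≡ suc (l ℕ.+ m)) → y (l ℕ.+ m) + (if r == P then α * y 0 else 0ℚ) ≡ path l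
    path-last zero    r≡ = cong (λ t → y m + (if t then α * y 0 else 0ℚ))
      (trans (cong (_== P) r≡) (==-refl P))
    path-last (suc l) r≡ = trans (cong (λ t → y (suc (l ℕ.+ m)) + (if t then α * y 0 else 0ℚ))
      (≢⇒== (λ e → ℕ.<⇒≢ (s≤s (s≤s (ℕ.m≤n+m m l))) (trans (sym e) r≡)))) (+-identityʳ _)

    on-tail : ∀ j → j ≤ suc (suc n) → tail j ≡ alt j (z (y 0) (y 1) + b) (w′ (y 0) (y 1))
    on-tail j j≤ = trans (alt-segment tail (suc n) tail-step j j≤)
      (cong₂ (alt j) (cong (_+ b) (on-path L (ℕ.n≤1+n L))) (on-path (suc L) ℕ.≤-refl))
      where
      tail-step : ∀ j → j < suc n → tail (suc (suc j)) ≡ - tail j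
      tail-step zero    _   = trans (step (L ℕ.+ m) r≤k) (cong -_ (trans
        (cong (λ t → y (L ℕ.+ m) + ((if r == P then α * y 0 else 0ℚ) + (if t then b else 0ℚ))) (==-refl r))
        (trans (sym (+-assoc (y (L ℕ.+ m)) (if r == P then α * y 0 else 0ℚ) b))
          (cong (_+ b) (path-last L refl)))))
      tail-step (suc j) (s≤s j<n) = free (j ℕ.+ r) (ℕ.+-monoˡ-≤ r j<n)
        (λ e → ℕ.<⇒≢ (s≤s (ℕ.≤-trans P≤r (ℕ.m≤n+m r j))) (sym e))
        (λ e → ℕ.<⇒≢ (s≤s (ℕ.m≤n+m r j)) (sym e))

  balanced⇒closes : ∀ y → Balanced y → Closes (y 0) (y 1) (β * y (suc k))
  balanced⇒closes y bal = record
    { closeP = trans (cong (λ s → y 1 + α * s) (sym (on-P P ℕ.≤-refl))) first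
    ; chordQ = cong (β *_) (on-tail (suc (suc n)) ℕ.≤-refl)
    ; closeQ = trans (cong₂ (λ s t → s + β * t)
        (sym (on-tail (suc n) (ℕ.n≤1+n _))) (sym (on-path (suc L) ℕ.≤-refl))) final
    }
    where
    open Balanced bal
    open Solve y (β * y (suc k)) inner

  solution : ℚ → ℚ → ℚ → ℕ → ℚ
  solution u v b = driven (source u b) u v

  -- The guess is confirmed: the recurrence driven by `b` ends in the value from which `chordQ`
  -- recovers `b`.
  solution-last : ∀ u v b → Closes u v b → β * solution u v b (suc k) ≡ b
  solution-last u v b closes =
    trans (cong (β *_) (on-tail (suc (suc n)) ℕ.≤-refl)) (sym (Closes.chordQ closes))
    where open Solve (solution u v b) b (λ _ _ → refl)

  closes⇒balanced : ∀ u v b → Closes u v b → Balanced (solution u v b)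
  closes⇒balanced u v b closes = record
    { first = trans (cong (λ s → v + α * s) (on-P P ℕ.≤-refl)) closeP
    ; inner = λ i _ → cong (λ s → - (solution u v b i + source u s i)) (sym (solution-last u v b closes))
    ; final = trans (cong₂ (λ s t → s + β * t) (on-tail (suc n) (ℕ.n≤1+n _)) (on-path (suc L) ℕ.≤-refl)) closeQ
    }
    where
    open Closes closes
    open Solve (solution u v b) b (λ _ _ → refl)

  -- With all three parameters zero the source vanishes and the recurrence starts from zeros; this
  -- is the injectivity behind every upper bound.
  balanced-zero : ∀ y → Balanced y → y 0 ≡ 0ℚ → y 1 ≡ 0ℚ → β * y (suc k) ≡ 0ℚ →
    ∀ j → j ≤ suc k → y j ≡ 0ℚ
  balanced-zero y bal y₀ y₁ b≡0 = driven-zero (source (y 0) (β * y (suc k))) y k (Balanced.inner bal)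
    (λ i → cong₂ _+_ (vanish (suc i == P) (trans (cong (α *_) y₀) (*-zeroʳ α))) (vanish (suc i == r) b≡0)) y₀ y₁
    where
    vanish : ∀ t {s} → s ≡ 0ℚ → (if t then s else 0ℚ) ≡ 0ℚ
    vanish true  e = e
    vanish false e = refl

  balanced-cong : ∀ y y′ → (∀ j → j < suc (suc k) → y j ≡ y′ j) → Balanced y → Balanced y′
  balanced-cong y y′ same bal = record
    { first = trans (sym (cong₂ (λ s t → s + α * t) (same 1 (s≤s (s≤s z≤n)))
        (same P (s≤s (ℕ.≤-trans P≤r (ℕ.m≤n⇒m≤1+n r≤k)))))) first
    ; inner = λ i i<k → trans (sym (same (suc (suc i)) (s≤s (s≤s i<k)))) (trans (inner i i<k)
        (cong -_ (cong₂ _+_ (same i (ℕ.m≤n⇒m≤1+n (ℕ.m≤n⇒m≤1+n i<k)))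
          (cong₂ (λ s t → source s (β * t) i) (same 0 (s≤s z≤n)) (same (suc k) ℕ.≤-refl)))))
    ; final = trans (sym (cong₂ (λ s t → s + β * t)
        (same k (s≤s (ℕ.n≤1+n k))) (same r (s≤s (ℕ.m≤n⇒m≤1+n r≤k))))) final
    }
    where open Balanced bal

-- Kernel vectors of the signed graph as solutions of the closing conditions

isPair-offPath : ∀ {c d} → suc c < d → OffPath (λ a b → isPair a b c d)
isPair-offPath {c} {d} 1+c<d a b t with T-isPair {a} {b} c d t
... | inj₁ (refl , refl) = ℕ.<⇒≢ 1+c<d , λ e → ℕ.<-asym (ℕ.<-trans (ℕ.n<1+n c) 1+c<d) (ℕ.≤-reflexive e)
... | inj₂ (refl , refl) = (λ e → ℕ.<-asym (ℕ.<-trans (ℕ.n<1+n c) 1+c<d) (ℕ.≤-reflexive e)) , ℕ.<⇒≢ 1+c<d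

∨-offPath : ∀ {e e′} → OffPath e → OffPath e′ → OffPath (λ a b → e a b ∨ e′ a b)
∨-offPath {e} off off′ a b t = [ off a b , off′ a b ] (to (T-∨ {e a b}) t)

switch-≥ : ∀ τ {n} (x : Fin n → ℚ) → switch τ x n ≡ 0ℚ
switch-≥ τ {n} x = trans (cong (pathSign τ n *_) (ext-≥ x ℕ.≤-refl)) (*-zeroʳ (pathSign τ n))

unswitch : (ℕ → ℕ → Sign) → (ℕ → ℚ) → ∀ {n} → Fin n → ℚ
unswitch τ y j = pathSign τ (toℕ j) * y (toℕ j)

switch-unswitch : ∀ τ y {n c} → c < n → switch τ (unswitch τ y {n}) c ≡ y c
switch-unswitch τ y {n} {c} c<n = trans
  (cong (pathSign τ c *_) (ext-< (λ c → pathSign τ c * y c) c<n))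
  (unit-cancelˡ (pathSign-unit τ c) (y c))

module Infinity (m L n : ℕ) (1≤m : 1 ≤ m) (1≤n : 1 ≤ n)
  (τ : ℕ → ℕ → Sign) (τ-sym : Symmetric τ) where

  open Rows τ τ-sym

  private
    D = pathSign τ

  α β : ℚ
  α = chordSign τ 0 (suc m)
  β = chordSign τ (suc (L ℕ.+ m)) (suc (n ℕ.+ suc (L ℕ.+ m)))

  α-unit : IsUnit α
  α-unit = chordSign-unit τ 0 (suc m)

  β-unit : IsUnit β
  β-unit = chordSign-unit τ (suc (L ℕ.+ m)) (suc (n ℕ.+ suc (L ℕ.+ m)))

  open Model m L n 1≤m 1≤n α β public

  chords : ℕ → ℕ → Bool
  chords a b = isPair a b 0 P ∨ isPair a b r (suc k)

  matrix : Matrix (suc (suc k))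
  matrix = signedMatrix (pathAnd chords) τ (suc (suc k))

  -- Here the cycle lengths of at least 3 enter: the closing edge of a shorter cycle would repeat a
  -- path edge.
  chords-offPath : OffPath chords
  chords-offPath = ∨-offPath {λ a b → isPair a b 0 P} (isPair-offPath (s≤s 1≤m))
    (isPair-offPath (s≤s (ℕ.+-monoˡ-≤ r 1≤n)))

  matrix-row : ∀ (x : Fin (suc (suc k)) → ℚ) a →
    D a * Σif (pathAnd chords a) (sgn ∘ τ a) x ≡ modelRow (switch τ x) a
  matrix-row x a = trans (switched-row chords chords-offPath x a)
    (cong (pathRow (switch τ x) a +_) (trans
      (cong (D a *_) (Σif-∨ (λ b → isPair a b 0 P) (λ b → isPair a b r (suc k)) (sgn ∘ τ a) x disjoint))
      (trans (solve 3 (λ d u v → d :* (u :+ v) := d :* u :+ d :* v) refl (D a)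
        (Σif (λ b → isPair a b 0 P) (sgn ∘ τ a) x) (Σif (λ b → isPair a b r (suc k)) (sgn ∘ τ a) x))
      (cong₂ _+_ (switched-isPair x (λ ()) a)
        (switched-isPair x (ℕ.<⇒≢ (s≤s (ℕ.m≤n+m r n))) a)))))
    where
    disjoint : ∀ b → T (isPair a b 0 P) → T (isPair a b r (suc k)) → ⊥
    disjoint b t t′ with T-isPair {a} {b} 0 P t | T-isPair {a} {b} r (suc k) t′
    ... | inj₁ (refl , _) | inj₁ (() , _)
    ... | inj₁ (refl , _) | inj₂ (() , _)
    ... | inj₂ (_ , refl) | inj₁ (_ , ())
    ... | inj₂ (_ , refl) | inj₂ (_ , ())

  -- A kernel vector is determined by its values at these three vertices, which
  -- up to sign are the parameters u, v, b of the model.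
  vertex : Fin 3 → Fin (suc (suc k))
  vertex 0F = 0F
  vertex 1F = 1F
  vertex 2F = F.fromℕ (suc k)

  scale : Fin 3 → ℚ
  scale 0F = D 0
  scale 1F = D 1
  scale 2F = β * D (suc k)

  scale-unit : ∀ i → IsUnit (scale i)
  scale-unit 0F = pathSign-unit τ 0
  scale-unit 1F = pathSign-unit τ 1
  scale-unit 2F = unit-* β-unit (pathSign-unit τ (suc k))

  Closed : (Fin 3 → ℚ) → Set
  Closed c = Closes (c 0F) (c 1F) (c 2F)

  switch-last : ∀ (x : Fin (suc (suc k)) → ℚ) →
    β * switch τ x (suc k) ≡ scale 2F * x (vertex 2F)
  switch-last x = trans (sym (*-assoc β (D (suc k)) (ext x (suc k))))
    (cong (scale 2F *_) (trans (cong (ext x) (sym (Fin.toℕ-fromℕ (suc k)))) (ext-toℕ x (F.fromℕ (suc k)))))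

  kernel⇒balanced : ∀ x → InKernel matrix x → Balanced (switch τ x)
  kernel⇒balanced x ker = rows⇒balanced (switch τ x) (switch-≥ τ x)
    (λ a a< → trans (sym (matrix-row x a)) (kernel⇒rows (pathAnd chords) x ker a a<))

  kernel⇒closed : ∀ x → InKernel matrix x → Closed (λ i → scale i * x (vertex i))
  kernel⇒closed x ker = subst (Closes (D 0 * x 0F) (D 1 * x 1F)) (switch-last x)
    (balanced⇒closes (switch τ x) (kernel⇒balanced x ker))

  kernel-zero : ∀ x → InKernel matrix x → (∀ i → scale i * x (vertex i) ≡ 0ℚ) → ∀ j → x j ≡ 0ℚ
  kernel-zero x ker zeros j = trans (sym (ext-toℕ x j)) (unit-cancel-zero (pathSign-unit τ (toℕ j))
    (balanced-zero (switch τ x) (kernel⇒balanced x ker) (zeros 0F) (zeros 1F)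
      (trans (switch-last x) (zeros 2F)) (toℕ j) (ℕ.≤-pred (Fin.toℕ<n j))))

  vector : (Fin 3 → ℚ) → Fin (suc (suc k)) → ℚ
  vector c = unswitch τ (solution (c 0F) (c 1F) (c 2F))

  vector-kernel : ∀ c → Closed c → InKernel matrix (vector c)
  vector-kernel c closed = rows⇒kernel (pathAnd chords) (vector c) (λ a a< →
    trans (matrix-row (vector c) a) (balanced⇒rows y′ (switch-≥ τ (vector c)) balanced a a<))
    where
    y = solution (c 0F) (c 1F) (c 2F)
    y′ = switch τ (vector c)
    same : ∀ j → j < suc (suc k) → y j ≡ y′ j
    same j j< = sym (switch-unswitch τ y j<)
    bal = closes⇒balanced (c 0F) (c 1F) (c 2F) closed
    balanced : Balanced y′
    balanced = balanced-cong y y′ same bal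

  vector-vertex : ∀ c → Closed c → ∀ i → vector c (vertex i) ≡ scale i * c i
  vector-vertex c closed 0F = refl
  vector-vertex c closed 1F = refl
  vector-vertex c closed 2F = trans
    (cong (λ j → D j * y j) (Fin.toℕ-fromℕ (suc k)))
    -- The square of `β` is inserted because `solution-last` controls `β` times the last value.
    (trans (cong (D (suc k) *_) (trans (sym (unit-cancelˡ β-unit (y (suc k))))
      (cong (β *_) (solution-last (c 0F) (c 1F) (c 2F) closed))))
    (solve 3 (λ d b c → d :* (b :* c) := b :* d :* c) refl (D (suc k)) β (c 2F)))
    where y = solution (c 0F) (c 1F) (c 2F)

  -- At the three special vertices the kernel vector built from `c` shows the parameters themselves
  -- up to sign, so a diagonal family of parameters gives a diagonal family of vectors.
  nullity≥ : ∀ {d} (idx : Fin d → Fin 3) (c : Fin d → Fin 3 → ℚ) → (∀ t → Closed (c t)) →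
    (∀ t → c t (idx t) ≢ 0ℚ) → (∀ t s → t ≢ s → c t (idx s) ≡ 0ℚ) → NullityAtLeast matrix d
  nullity≥ idx c closed diag off = vector ∘ c , (λ t → vector-kernel (c t) (closed t)) ,
    LinIndep-diagonal (vector ∘ c) (vertex ∘ idx)
      (λ t e → diag t (unit-cancel-zero (scale-unit (idx t)) (trans (sym (vector-vertex (c t) (closed t) (idx t))) e)))
      (λ t s t≢s → trans (vector-vertex (c t) (closed t) (idx s))
        (trans (cong (scale (idx s) *_) (off t s t≢s)) (*-zeroʳ (scale (idx s)))))

  -- The matching upper bound: parameters that determine the other ones determine the kernel vector.
  nullity< : ∀ {d} (idx : Fin d → Fin 3) →
    (∀ c → Closed c → (∀ t → c (idx t) ≡ 0ℚ) → ∀ i → c i ≡ 0ℚ) → ¬ NullityAtLeast matrix (suc d)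
  nullity< idx determined = ¬NullityAtLeast-coordinates matrix (vertex ∘ idx) (λ x ker zeros →
    kernel-zero x ker (determined (λ i → scale i * x (vertex i)) (kernel⇒closed x ker)
      (λ t → trans (cong (scale (idx t) *_) (zeros t)) (*-zeroʳ (scale (idx t))))))

-- The kernel of a single signed cycle

module Cycle (m : ℕ) (1≤m : 1 ≤ m) (τ : ℕ → ℕ → Sign) (τ-sym : Symmetric τ) where

  open Rows τ τ-sym

  γ : ℚ
  γ = chordSign τ 0 (suc m)

  γ-unit : IsUnit γ
  γ-unit = chordSign-unit τ 0 (suc m)

  closing : ℕ → ℕ → Bool
  closing a b = isPair a b 0 (suc m)

  cycle : Matrix (suc (suc m))
  cycle = signedMatrix (pathAnd closing) τ (suc (suc m))

  cycle-row : ∀ (x : Fin (suc (suc m)) → ℚ) a →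
    pathSign τ a * Σif (pathAnd closing a) (sgn ∘ τ a) x
      ≡ pathRow (switch τ x) a + chordRow γ 0 (suc m) (switch τ x) a
  cycle-row x a = trans (switched-row closing (isPair-offPath (s≤s 1≤m)) x a)
    (cong (pathRow (switch τ x) a +_) (switched-isPair x (λ ()) a))

  row-first : ∀ y → pathRow y 0 + chordRow γ 0 (suc m) y 0 ≡ y 1 + γ * y (suc m)
  row-first y = cong (y 1 +_) (+-identityʳ _)

  row-inner : ∀ y i → i < m →
    pathRow y (suc i) + chordRow γ 0 (suc m) y (suc i) ≡ y (suc (suc i)) + y i
  row-inner y i i<m = trans
    (cong (λ t → pathRow y (suc i) + (0ℚ + (if t then γ * y 0 else 0ℚ))) (≢⇒== (ℕ.<⇒≢ (s≤s i<m))))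
    (+-identityʳ _)

  row-final : ∀ y → y (suc (suc m)) ≡ 0ℚ →
    pathRow y (suc m) + chordRow γ 0 (suc m) y (suc m) ≡ y m + γ * y 0
  row-final y beyond = trans
    (cong₂ (λ s t → s + y m + (0ℚ + (if t then γ * y 0 else 0ℚ))) beyond (==-refl (suc m)))
    (solve 2 (λ a b → con 0ℚ :+ a :+ (con 0ℚ :+ b) := a :+ b) refl (y m) (γ * y 0))

  -- If the two closing equations force the starting values to vanish, the recurrence spreads the
  -- zeros around the cycle; so an empty set of coordinates already determines a kernel vector.
  cycle-trivial : (∀ u v → v + γ * alt (suc m) u v ≡ 0ℚ → alt m u v + γ * u ≡ 0ℚ → u ≡ 0ℚ × v ≡ 0ℚ) →
    ¬ NullityAtLeast cycle 1
  cycle-trivial only-zero = ¬NullityAtLeast-coordinates cycle (λ ()) λ x ker _ j →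
    let y = switch τ x
        row : ∀ a → a < suc (suc m) → pathRow y a + chordRow γ 0 (suc m) y a ≡ 0ℚ
        row a a< = trans (sym (cycle-row x a)) (kernel⇒rows (pathAnd closing) x ker a a<)
        step : ∀ i → i < m → y (suc (suc i)) ≡ - (y i + 0ℚ)
        step i i<m = +≡0⇒≡- (trans (+-identityʳ _)
          (trans (sym (row-inner y i i<m)) (row (suc i) (s≤s (ℕ.m≤n⇒m≤1+n i<m)))))
        on-cycle = alt-segment y m (λ i i<m → trans (step i i<m) (cong -_ (+-identityʳ (y i))))
        u≡0 , v≡0 = only-zero (y 0) (y 1)
          (trans (cong (λ s → y 1 + γ * s) (sym (on-cycle (suc m) ℕ.≤-refl)))
            (trans (sym (row-first y)) (row 0 (s≤s z≤n))))
          (trans (cong (_+ γ * y 0) (sym (on-cycle m (ℕ.n≤1+n m))))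
            (trans (sym (row-final y (switch-≥ τ x))) (row (suc m) ℕ.≤-refl)))
    in trans (sym (ext-toℕ x j)) (unit-cancel-zero (pathSign-unit τ (toℕ j))
      (driven-zero (λ _ → 0ℚ) y m step (λ _ → refl) u≡0 v≡0 (toℕ j) (ℕ.≤-pred (Fin.toℕ<n j))))

  cycle-singular : ∀ u v → u ≢ 0ℚ → v + γ * alt (suc m) u v ≡ 0ℚ → alt m u v + γ * u ≡ 0ℚ →
    NullityAtLeast cycle 1
  cycle-singular u v u≢0 closeˡ closeʳ = (λ _ → x) ,
    (λ _ → rows⇒kernel (pathAnd closing) x (λ a a< → trans (cycle-row x a) (rows a a<))) ,
    LinIndep-diagonal (λ (_ : Fin 1) → x) (λ _ → 0F)
      (λ _ e → u≢0 (trans (sym (*-identityˡ u)) e)) (λ { 0F 0F ne → contradiction refl ne })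
    where
    x : Fin (suc (suc m)) → ℚ
    x = unswitch τ (λ i → alt i u v)
    y = switch τ x
    at : ∀ {j} → j < suc (suc m) → y j ≡ alt j u v
    at = switch-unswitch τ (λ i → alt i u v)
    rows : ∀ a → a < suc (suc m) → pathRow y a + chordRow γ 0 (suc m) y a ≡ 0ℚ
    rows zero a< = trans (row-first y)
      (trans (cong₂ (λ s t → s + γ * t) (at (s≤s (s≤s z≤n))) (at ℕ.≤-refl)) closeˡ)
    rows (suc i) (s≤s (s≤s i≤m)) with ℕ.m≤n⇒m<n∨m≡n i≤m
    ... | inj₁ i<m  = trans (row-inner y i i<m) (trans
      (cong₂ _+_ (at (s≤s (s≤s i<m))) (at (s≤s (ℕ.m≤n⇒m≤1+n i≤m))))
      (solve 1 (λ a → :- a :+ a := con 0ℚ) refl (alt i u v)))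
    ... | inj₂ refl = trans (row-final y (switch-≥ τ x))
      (trans (cong₂ (λ s t → s + γ * t) (at (s≤s (ℕ.n≤1+n i))) (at (s≤s z≤n))) closeʳ)

-- Powers of minus one and the closed form of the recurrence

sg : ℕ → ℚ
sg zero    = 1ℚ
sg (suc n) = - sg n

unit-neg : ∀ {s} → IsUnit s → IsUnit (- s)
unit-neg (inj₁ refl) = inj₂ refl
unit-neg (inj₂ refl) = inj₁ refl

sg-unit : ∀ n → IsUnit (sg n)
sg-unit zero    = inj₁ refl
sg-unit (suc n) = unit-neg (sg-unit n)

unit-dichotomy : ∀ {s t} → IsUnit s → IsUnit t → s ≡ t ⊎ s ≡ - t
unit-dichotomy (inj₁ refl) (inj₁ refl) = inj₁ refl
unit-dichotomy (inj₁ refl) (inj₂ refl) = inj₂ refl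
unit-dichotomy (inj₂ refl) (inj₁ refl) = inj₂ refl
unit-dichotomy (inj₂ refl) (inj₂ refl) = inj₁ refl

alt-even : ∀ h u v → alt (h ℕ.* 2) u v ≡ sg h * u
alt-even zero    u v = sym (*-identityˡ u)
alt-even (suc h) u v = trans (cong -_ (alt-even h u v))
  (solve 2 (λ s u → :- (s :* u) := (:- s) :* u) refl (sg h) u)

alt-odd : ∀ h u v → alt (suc (h ℕ.* 2)) u v ≡ sg h * v
alt-odd zero    u v = sym (*-identityˡ v)
alt-odd (suc h) u v = trans (cong -_ (alt-odd h u v))
  (solve 2 (λ s u → :- (s :* u) := (:- s) :* u) refl (sg h) v)

alt-zero : ∀ i → alt i 0ℚ 0ℚ ≡ 0ℚ
alt-zero zero          = refl
alt-zero (suc zero)    = refl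
alt-zero (suc (suc i)) = cong -_ (alt-zero i)

double-zero : ∀ {x} → x + x ≡ 0ℚ → x ≡ 0ℚ
double-zero {x} e = trans (solve 1 (λ x → x := con ½ :* (x :+ x)) refl x)
  (trans (cong (½ *_) e) (*-zeroʳ ½))

-- The equation is `3y = 0` for `t = 1` and `5y = 0` for `t = -1`. The factor 4 arises when each of
-- two odd cycles contributes a factor 2.
four-fold-fixed : ∀ {t} → IsUnit t → ∀ {y} → y ≡ t * ((y + y) + (y + y)) → y ≡ 0ℚ
four-fold-fixed (inj₁ refl) {y} e = *-zero-cancelʳ y {1ℚ + 1ℚ + 1ℚ} (λ ()) (trans
  (solve 1 (λ y → y :* con (1ℚ + 1ℚ + 1ℚ) := con 1ℚ :* ((y :+ y) :+ (y :+ y)) :+ :- y) refl y)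
  (trans (cong (_+ - y) (sym e)) (+-inverseʳ y)))
four-fold-fixed (inj₂ refl) {y} e = *-zero-cancelʳ y {1ℚ + 1ℚ + 1ℚ + 1ℚ + 1ℚ} (λ ()) (trans
  (solve 1 (λ y → y :* con (1ℚ + 1ℚ + 1ℚ + 1ℚ + 1ℚ) := y :+ :- (con (- 1ℚ) :* ((y :+ y) :+ (y :+ y)))) refl y)
  (trans (cong (λ s → y + - s) (sym e)) (+-inverseʳ y)))

-- The lines imposed by the two cycles and their transport along the path

module Nullities (m L n : ℕ) (1≤m : 1 ≤ m) (1≤n : 1 ≤ n)
  (τ : ℕ → ℕ → Sign) (τ-sym : Symmetric τ) where

  open Infinity m L n 1≤m 1≤n τ τ-sym public

  LeftClosed : ℚ → ℚ → Set
  LeftClosed u v = v + α * w u v ≡ 0ℚ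

  -- The second cycle sees the rest of the graph only through `Z` and `W`, so its two conditions can
  -- be analysed apart from `u` and `v`.
  record RightClosed (Z W b : ℚ) : Set where
    constructor joined
    field
      chord : b ≡ β * alt (suc (suc n)) (Z + b) W
      close : alt (suc n) (Z + b) W + β * W ≡ 0ℚ

  closes : ∀ {u v b} → LeftClosed u v → RightClosed (z u v) (w′ u v) b → Closes u v b
  closes left (joined chord close) = record { closeP = left ; chordQ = chord ; closeQ = close }

  leftClosed : ∀ {u v b} → Closes u v b → LeftClosed u v
  leftClosed = Closes.closeP

  rightClosed : ∀ {u v b} → Closes u v b → RightClosed (z u v) (w′ u v) b
  rightClosed c = joined (Closes.chordQ c) (Closes.closeQ c)

  -- For an odd cycle `w` is `u` up to sign, and the closed pairs (u, v) form the line through `1`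
  -- and `partner`; hence no freedom is left once `w` vanishes.
  record LeftOdd (κ : ℚ) : Set where
    field
      κ-unit  : IsUnit κ
      g≡2κw   : ∀ {u v} → LeftClosed u v → g u v ≡ κ * w u v + κ * w u v
      w≡0⇒u≡0 : ∀ {u v} → w u v ≡ 0ℚ → u ≡ 0ℚ
      w≡0⇒v≡0 : ∀ {u v} → LeftClosed u v → w u v ≡ 0ℚ → v ≡ 0ℚ
      u≡0⇒w≡0 : ∀ {u v} → u ≡ 0ℚ → w u v ≡ 0ℚ
      partner : ℚ
      closed  : LeftClosed 1ℚ partner

  -- Matched and unmatched are the even cycles of nullity 2 and 0.
  record LeftMatched : Set where
    field
      closed : ∀ u v → LeftClosed u v
      g≡0    : ∀ u v → g u v ≡ 0ℚ
      δ      : ℚ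
      δ-unit : IsUnit δ
      w≡δv   : ∀ u v → w u v ≡ δ * v

    w≡0⇒v≡0 : ∀ {u v} → w u v ≡ 0ℚ → v ≡ 0ℚ
    w≡0⇒v≡0 {u} {v} e = unit-cancel-zero δ-unit (trans (sym (w≡δv u v)) e)

    w≡0 : ∀ u → w u 0ℚ ≡ 0ℚ
    w≡0 u = trans (w≡δv u 0ℚ) (*-zeroʳ δ)

  record LeftUnmatched : Set where
    field
      v≡0     : ∀ {u v} → LeftClosed u v → v ≡ 0ℚ
      closed  : ∀ u → LeftClosed u 0ℚ
      w≡0     : ∀ u → w u 0ℚ ≡ 0ℚ
      g≡0⇒u≡0 : ∀ {u v} → g u v ≡ 0ℚ → u ≡ 0ℚ
      u≡0⇒g≡0 : ∀ {u v} → u ≡ 0ℚ → g u v ≡ 0ℚ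

    left-w≡0 : ∀ {u v} → LeftClosed u v → w u v ≡ 0ℚ
    left-w≡0 {u} c = trans (cong (w u) (v≡0 c)) (w≡0 u)

  -- The two neighbours inside the cycle add up to `κ * W + κ * W`, and `b` is one of the two equal
  -- terms; the row of the attaching vertex makes `Z` the negative of this sum.
  record RightOdd (κ : ℚ) : Set where
    constructor right-odd-by
    field
      closed⇔ : ∀ {Z W b} → RightClosed Z W b ⇔ (b ≡ κ * W × Z ≡ - (κ * W + κ * W))

  -- Both `W` and `b` stay free; `b` is the amplitude of a kernel vector of the cycle that vanishes
  -- at the attaching vertex.
  RightMatched : Set
  RightMatched = ∀ {Z W b} → RightClosed Z W b ⇔ Z ≡ 0ℚ

  -- Here `b` is half of `- Z`, so the cycle adds no parameter of its own.
  RightUnmatched : Set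
  RightUnmatched = ∀ {Z W b} → RightClosed Z W b ⇔ (W ≡ 0ℚ × Z + (b + b) ≡ 0ℚ)

  left-odd : ∀ h → m ≡ suc (h ℕ.* 2) → LeftOdd (α * sg (suc h))
  left-odd h m≡ = record
    { κ-unit  = unit-* α-unit (sg-unit (suc h))
    ; g≡2κw   = λ {u} {v} e → trans (cong (_+ α * u) (trans (alt-m u v) (trans (cong (sg h *_) (v≡ u v e))
        (solve 3 (λ s a u → s :* (a :* (s :* u)) := s :* (s :* (a :* u))) refl (sg h) α u))))
        (cong₂ _+_ (κw≡ u v) (trans (sym (unit-cancelˡ (sg-unit h) (α * u))) (κw≡ u v)))
    ; w≡0⇒u≡0 = λ {u} {v} e → unit-cancel-zero (unit-neg (sg-unit h)) (trans
        (solve 2 (λ s u → (:- s) :* u := :- (s :* u)) refl (sg h) u) (trans (sym (w≡ u v)) e))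
    ; w≡0⇒v≡0 = λ {u} {v} c e → trans (sym (+-identityʳ v)) (trans
        (cong (v +_) (trans (sym (*-zeroʳ α)) (cong (α *_) (sym e)))) c)
    ; u≡0⇒w≡0 = λ {u} {v} e → trans (w≡ u v) (trans (cong (λ s → - (sg h * s)) e)
        (cong -_ (*-zeroʳ (sg h))))
    -- The value of `v` that the first closing condition forces for `u = 1`.
    ; partner = α * sg h
    ; closed  = trans (cong (λ s → α * sg h + α * s) (w≡ 1ℚ (α * sg h)))
        (solve 2 (λ a s → a :* s :+ a :* (:- (s :* con 1ℚ)) := con 0ℚ) refl α (sg h))
    }
    where
    alt-m : ∀ u v → alt m u v ≡ sg h * v
    alt-m u v = trans (cong (λ i → alt i u v) m≡) (alt-odd h u v)
    w≡ : ∀ u v → w u v ≡ - (sg h * u)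
    w≡ u v = trans (cong (λ i → alt (suc i) u v) m≡) (cong -_ (alt-even h u v))
    κw≡ : ∀ u v → sg h * (sg h * (α * u)) ≡ α * sg (suc h) * w u v
    κw≡ u v = trans (solve 3 (λ s a u → s :* (s :* (a :* u)) := a :* (:- s) :* (:- (s :* u))) refl (sg h) α u)
      (cong (α * sg (suc h) *_) (sym (w≡ u v)))
    v≡ : ∀ u v → LeftClosed u v → v ≡ α * (sg h * u)
    v≡ u v e = trans (solve 4 (λ v a s u → v := (v :+ a :* (:- (s :* u))) :+ a :* (s :* u)) refl v α (sg h) u)
      (trans (cong (_+ α * (sg h * u)) (trans (cong (λ s → v + α * s) (sym (w≡ u v))) e)) (+-identityˡ _))

  module _ (h : ℕ) (m≡ : m ≡ h ℕ.* 2) where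
    private
      g≡ : ∀ u v → g u v ≡ sg h * u + α * u
      g≡ u v = cong (_+ α * u) (trans (cong (λ i → alt i u v) m≡) (alt-even h u v))
      w≡ : ∀ u v → w u v ≡ sg h * v
      w≡ u v = trans (cong (λ i → alt (suc i) u v) m≡) (alt-odd h u v)
      left≡ : ∀ u v → v + α * w u v ≡ v + α * (sg h * v)
      left≡ u v = cong (λ s → v + α * s) (w≡ u v)

    left-matched : α ≡ - sg h → LeftMatched
    left-matched α≡ = record
      { closed = λ u v → trans (left≡ u v) (trans (cong (λ s → v + s * (sg h * v)) α≡)
          (trans (solve 2 (λ s v → v :+ (:- s) :* (s :* v) := v :+ :- (s :* (s :* v))) refl (sg h) v)
          (trans (cong (λ s → v + - s) (unit-cancelˡ (sg-unit h) v)) (+-inverseʳ v))))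
      ; g≡0    = λ u v → trans (g≡ u v) (trans (cong (λ s → sg h * u + s * u) α≡)
          (solve 2 (λ s u → s :* u :+ (:- s) :* u := con 0ℚ) refl (sg h) u))
      ; δ      = sg h
      ; δ-unit = sg-unit h
      ; w≡δv   = w≡
      }

    left-unmatched : α ≡ sg h → LeftUnmatched
    left-unmatched α≡ = record
      { v≡0     = λ {u} {v} c → double-zero (trans (cong (v +_) (trans (sym (unit-cancelˡ (sg-unit h) v))
          (cong (_* (sg h * v)) (sym α≡)))) (trans (sym (left≡ u v)) c))
      ; closed  = λ u → trans (left≡ u 0ℚ) (solve 2 (λ a s → con 0ℚ :+ a :* (s :* con 0ℚ) := con 0ℚ) refl α (sg h))
      ; w≡0     = λ u → trans (w≡ u 0ℚ) (*-zeroʳ (sg h))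
      ; g≡0⇒u≡0 = λ {u} {v} e → unit-cancel-zero (sg-unit h) (double-zero
          (trans (cong (λ s → sg h * u + s * u) (sym α≡)) (trans (sym (g≡ u v)) e)))
      ; u≡0⇒g≡0 = λ {u} {v} e → trans (g≡ u v) (trans (cong (λ s → sg h * s + α * s) e)
          (solve 2 (λ s a → s :* con 0ℚ :+ a :* con 0ℚ := con 0ℚ) refl (sg h) α))
      }

  right-odd : ∀ h → n ≡ suc (h ℕ.* 2) → RightOdd (β * sg (suc h))
  right-odd h n≡ = right-odd-by (λ {Z} {W} {b} → mk⇔ (forward Z W b) (backward Z W b))
    where
    κ = β * sg (suc h)
    module _ (Z W b : ℚ) where
      chord≡ : β * alt (suc (suc n)) (Z + b) W ≡ κ * W
      chord≡ = trans (cong (λ i → β * alt (suc (suc i)) (Z + b) W) n≡) (trans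
        (cong (β *_) (alt-odd (suc h) (Z + b) W)) (sym (*-assoc β (sg (suc h)) W)))
      -- Pulling out a unit brings the last row to `(Z + b) + κ * W`, which becomes the relation
      -- between `Z` and `W` once `b` is known to be `κ * W`.
      close≡ : alt (suc n) (Z + b) W + β * W ≡ - sg h * ((Z + b) + κ * W)
      close≡ = trans
        (cong (_+ β * W) (trans (cong (λ i → alt (suc i) (Z + b) W) n≡) (alt-even (suc h) (Z + b) W)))
        (trans (cong (λ s → - sg h * (Z + b) + s) (sym (unit-cancelˡ (sg-unit h) (β * W))))
        (solve 5 (λ s Z b β W → (:- s) :* (Z :+ b) :+ s :* (s :* (β :* W)) :=
          (:- s) :* ((Z :+ b) :+ β :* (:- s) :* W)) refl (sg h) Z b β W))
      forward : RightClosed Z W b → b ≡ κ * W × Z ≡ - (κ * W + κ * W)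
      forward (joined chord close) = b≡ , trans
        (solve 2 (λ Z c → Z := ((Z :+ c) :+ c) :+ :- (c :+ c)) refl Z (κ * W))
        (trans (cong (_+ - (κ * W + κ * W)) (trans (cong (λ s → (Z + s) + κ * W) (sym b≡))
          (unit-cancel-zero (unit-neg (sg-unit h)) (trans (sym close≡) close))))
        (+-identityˡ _))
        where b≡ = trans chord chord≡
      backward : b ≡ κ * W × Z ≡ - (κ * W + κ * W) → RightClosed Z W b
      backward (b≡ , Z≡) = joined (trans b≡ (sym chord≡)) (trans close≡ (trans
        (cong₂ (λ s t → - sg h * ((s + t) + κ * W)) Z≡ b≡)
        (solve 2 (λ s c → (:- s) :* ((:- (c :+ c) :+ c) :+ c) := con 0ℚ) refl (sg h) (κ * W))))

  module _ (h : ℕ) (n≡ : n ≡ h ℕ.* 2) where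
    private
      chord≡ : ∀ {Z W b} → β * alt (suc (suc n)) (Z + b) W ≡ β * (- sg h * (Z + b))
      chord≡ {Z} {W} {b} = trans (cong (λ i → β * alt (suc (suc i)) (Z + b) W) n≡)
        (cong (β *_) (alt-even (suc h) (Z + b) W))
      close≡ : ∀ {Z W b} → alt (suc n) (Z + b) W + β * W ≡ sg h * W + β * W
      close≡ {Z} {W} {b} = cong (_+ β * W) (trans (cong (λ i → alt (suc i) (Z + b) W) n≡) (alt-odd h (Z + b) W))

    -- For this sign `chordQ` becomes `b ≡ Z + b`, and `closeQ` holds identically.
    right-matched : β ≡ - sg h → RightMatched
    right-matched β≡ {Z} {W} {b} = mk⇔ forward backward
      where
      chord≡′ : β * alt (suc (suc n)) (Z + b) W ≡ Z + b
      chord≡′ = trans (chord≡ {Z} {W} {b}) (trans (cong (_* (- sg h * (Z + b))) β≡)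
        (unit-cancelˡ (unit-neg (sg-unit h)) (Z + b)))
      forward : RightClosed Z W b → Z ≡ 0ℚ
      forward (joined chord _) = trans (solve 2 (λ Z b → Z := (Z :+ b) :+ :- b) refl Z b)
        (trans (cong (_+ - b) (sym (trans chord chord≡′))) (+-inverseʳ b))
      backward : Z ≡ 0ℚ → RightClosed Z W b
      backward Z≡0 = joined (trans (trans (sym (+-identityˡ b)) (cong (_+ b) (sym Z≡0))) (sym chord≡′))
        (trans (close≡ {Z} {W} {b}) (trans (cong (λ s → sg h * W + s * W) β≡)
          (solve 2 (λ s W → s :* W :+ (:- s) :* W := con 0ℚ) refl (sg h) W)))

    -- For this sign `chordQ` becomes `b ≡ - (Z + b)`, and in `closeQ` the two terms add up to `2W`
    -- up to sign.
    right-unmatched : β ≡ sg h → RightUnmatched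
    right-unmatched β≡ {Z} {W} {b} = mk⇔ forward backward
      where
      chord≡′ : β * alt (suc (suc n)) (Z + b) W ≡ - (Z + b)
      chord≡′ = trans (chord≡ {Z} {W} {b}) (trans (cong (_* (- sg h * (Z + b))) β≡) (trans
        (solve 2 (λ s x → s :* ((:- s) :* x) := :- (s :* (s :* x))) refl (sg h) (Z + b))
        (cong -_ (unit-cancelˡ (sg-unit h) (Z + b)))))
      forward : RightClosed Z W b → W ≡ 0ℚ × Z + (b + b) ≡ 0ℚ
      forward (joined chord close) =
        unit-cancel-zero (sg-unit h) (double-zero (trans (cong (λ s → sg h * W + s * W) (sym β≡))
          (trans (sym (close≡ {Z} {W} {b})) close))) ,
        trans (sym (+-assoc Z b b)) (trans
          (cong ((Z + b) +_) (trans chord chord≡′)) (+-inverseʳ (Z + b)))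
      backward : W ≡ 0ℚ × Z + (b + b) ≡ 0ℚ → RightClosed Z W b
      backward (W≡0 , Z≡) = joined
        (trans (trans (solve 2 (λ Z b → b := (Z :+ (b :+ b)) :+ :- (Z :+ b)) refl Z b)
          (trans (cong (_+ - (Z + b)) Z≡) (+-identityˡ _))) (sym chord≡′))
        (trans (close≡ {Z} {W} {b}) (trans (cong (λ s → sg h * s + β * s) W≡0)
          (solve 2 (λ s t → s :* con 0ℚ :+ t :* con 0ℚ := con 0ℚ) refl (sg h) β)))

  record Straight : Set where
    field
      s      : ℚ
      s-unit : IsUnit s
      z≡sg   : ∀ u v → z u v ≡ s * g u v
      w′≡sw  : ∀ u v → w′ u v ≡ s * w u v

    z≡0⇒g≡0 : ∀ {u v} → z u v ≡ 0ℚ → g u v ≡ 0ℚ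
    z≡0⇒g≡0 e = unit-cancel-zero s-unit (trans (sym (z≡sg _ _)) e)
    g≡0⇒z≡0 : ∀ {u v} → g u v ≡ 0ℚ → z u v ≡ 0ℚ
    g≡0⇒z≡0 e = trans (z≡sg _ _) (trans (cong (s *_) e) (*-zeroʳ s))
    w′≡0⇒w≡0 : ∀ {u v} → w′ u v ≡ 0ℚ → w u v ≡ 0ℚ
    w′≡0⇒w≡0 e = unit-cancel-zero s-unit (trans (sym (w′≡sw _ _)) e)
    w≡0⇒w′≡0 : ∀ {u v} → w u v ≡ 0ℚ → w′ u v ≡ 0ℚ
    w≡0⇒w′≡0 e = trans (w′≡sw _ _) (trans (cong (s *_) e) (*-zeroʳ s))

  -- Up to a common sign this is a quarter turn of the plane, hence the minus sign in the second
  -- component.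
  record Crossed : Set where
    field
      s       : ℚ
      s-unit  : IsUnit s
      z≡sw    : ∀ u v → z u v ≡ s * w u v
      w′≡-sg  : ∀ u v → w′ u v ≡ - s * g u v

    z≡0⇒w≡0 : ∀ {u v} → z u v ≡ 0ℚ → w u v ≡ 0ℚ
    z≡0⇒w≡0 e = unit-cancel-zero s-unit (trans (sym (z≡sw _ _)) e)
    w≡0⇒z≡0 : ∀ {u v} → w u v ≡ 0ℚ → z u v ≡ 0ℚ
    w≡0⇒z≡0 e = trans (z≡sw _ _) (trans (cong (s *_) e) (*-zeroʳ s))
    w′≡0⇒g≡0 : ∀ {u v} → w′ u v ≡ 0ℚ → g u v ≡ 0ℚ
    w′≡0⇒g≡0 e = unit-cancel-zero (unit-neg s-unit) (trans (sym (w′≡-sg _ _)) e)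
    g≡0⇒w′≡0 : ∀ {u v} → g u v ≡ 0ℚ → w′ u v ≡ 0ℚ
    g≡0⇒w′≡0 e = trans (w′≡-sg _ _) (trans (cong (- s *_) e) (*-zeroʳ (- s)))

  straight : ∀ h → L ≡ h ℕ.* 2 → Straight
  straight h L≡ = record
    { s = sg h ; s-unit = sg-unit h
    ; z≡sg  = λ u v → trans (cong (λ i → alt i (g u v) (w u v)) L≡) (alt-even h (g u v) (w u v))
    ; w′≡sw = λ u v → trans (cong (λ i → alt (suc i) (g u v) (w u v)) L≡) (alt-odd h (g u v) (w u v))
    }

  crossed : ∀ h → L ≡ suc (h ℕ.* 2) → Crossed
  crossed h L≡ = record
    { s = sg h ; s-unit = sg-unit h
    ; z≡sw   = λ u v → trans (cong (λ i → alt i (g u v) (w u v)) L≡) (alt-odd h (g u v) (w u v))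
    ; w′≡-sg = λ u v → trans (cong (λ i → alt (suc i) (g u v) (w u v)) L≡) (alt-even (suc h) (g u v) (w u v))
    }

  all-zero : ∀ (c : Fin 3 → ℚ) → c 0F ≡ 0ℚ → c 1F ≡ 0ℚ → c 2F ≡ 0ℚ → ∀ i → c i ≡ 0ℚ
  all-zero c u v b 0F = u
  all-zero c u v b 1F = v
  all-zero c u v b 2F = b

  nullity₀ : (∀ u v b → Closes u v b → u ≡ 0ℚ × v ≡ 0ℚ × b ≡ 0ℚ) → Nullity matrix 0
  nullity₀ zeros = nullity≥ (λ ()) (λ ()) (λ ()) (λ ()) (λ ()) ,
    nullity< (λ ()) (λ c closed _ → let (u , v , b) = zeros _ _ _ closed in all-zero c u v b)

  -- The suffix names the parameter that serves as coordinate on the one-dimensional solution space.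
  nullity₁-u : ∀ v b → Closes 1ℚ v b → (∀ v b → Closes 0ℚ v b → v ≡ 0ℚ × b ≡ 0ℚ) → Nullity matrix 1
  nullity₁-u v b closed zeros =
    nullity≥ (λ _ → 0F) (λ _ → 1ℚ ∷ v ∷ b ∷ []) (λ _ → closed) (λ _ ()) (λ { 0F 0F ne → contradiction refl ne }) ,
    nullity< (λ _ → 0F) (λ c closed e →
      let (v , b) = zeros _ _ (subst (λ u → Closes u (c 1F) (c 2F)) (e 0F) closed) in
      all-zero c (e 0F) v b)

  nullity₁-b : Closes 0ℚ 0ℚ 1ℚ → (∀ u v → Closes u v 0ℚ → u ≡ 0ℚ × v ≡ 0ℚ) → Nullity matrix 1
  nullity₁-b closed zeros =
    nullity≥ (λ _ → 2F) (λ _ → 0ℚ ∷ 0ℚ ∷ 1ℚ ∷ []) (λ _ → closed) (λ _ ()) (λ { 0F 0F ne → contradiction refl ne }) ,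
    nullity< (λ _ → 2F) (λ c closed e → let (u , v) = zeros _ _ (subst (Closes (c 0F) (c 1F)) (e 0F) closed) in
      all-zero c u v (e 0F))

  -- Coordinates are `u` and `b`; `v` is left open in the second basis vector because `b = 1` may
  -- force it to be nonzero.
  nullity₂ : ∀ v → Closes 1ℚ 0ℚ 0ℚ → Closes 0ℚ v 1ℚ → (∀ v → Closes 0ℚ v 0ℚ → v ≡ 0ℚ) → Nullity matrix 2
  nullity₂ v closed₁ closed₂ zeros =
    nullity≥ (0F ∷ 2F ∷ []) ((1ℚ ∷ 0ℚ ∷ 0ℚ ∷ []) ∷ (0ℚ ∷ v ∷ 1ℚ ∷ []) ∷ [])
      (λ { 0F → closed₁ ; 1F → closed₂ }) (λ { 0F () ; 1F () })
      (λ { 0F 0F ne → contradiction refl ne ; 0F 1F _ → refl ; 1F 0F _ → refl ; 1F 1F ne → contradiction refl ne }) ,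
    nullity< (0F ∷ 2F ∷ []) (λ c closed e →
      all-zero c (e 0F) (zeros (c 1F) (subst₂ (λ u b → Closes u (c 1F) b) (e 0F) (e 1F) closed)) (e 1F))

  nullity₃ : Closes 1ℚ 0ℚ 0ℚ → Closes 0ℚ 1ℚ 0ℚ → Closes 0ℚ 0ℚ 1ℚ → Nullity matrix 3
  nullity₃ closed₁ closed₂ closed₃ =
    nullity≥ (λ i → i) ((1ℚ ∷ 0ℚ ∷ 0ℚ ∷ []) ∷ (0ℚ ∷ 1ℚ ∷ 0ℚ ∷ []) ∷ (0ℚ ∷ 0ℚ ∷ 1ℚ ∷ []) ∷ [])
      (λ { 0F → closed₁ ; 1F → closed₂ ; 2F → closed₃ }) (λ { 0F () ; 1F () ; 2F () })
      (λ { 0F 0F ne → contradiction refl ne ; 0F 1F _ → refl ; 0F 2F _ → refl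
         ; 1F 0F _ → refl ; 1F 1F ne → contradiction refl ne ; 1F 2F _ → refl
         ; 2F 0F _ → refl ; 2F 1F _ → refl ; 2F 2F ne → contradiction refl ne }) ,
    nullity< (λ i → i) (λ c _ e → e)

-- Relative position of the two lines, case by case

module Cases (m L n : ℕ) (1≤m : 1 ≤ m) (1≤n : 1 ≤ n)
  (τ : ℕ → ℕ → Sign) (τ-sym : Symmetric τ) where

  open Nullities m L n 1≤m 1≤n τ τ-sym public
  open RightOdd

  module _ {κ′} (rightOdd : RightOdd κ′) where

    w′≡0⇒b≡0 : ∀ {u v b} → Closes u v b → w′ u v ≡ 0ℚ → b ≡ 0ℚ
    w′≡0⇒b≡0 c e = trans (proj₁ (to (closed⇔ rightOdd) (rightClosed c))) (trans (cong (κ′ *_) e) (*-zeroʳ κ′))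

    w′≡0⇒z≡0 : ∀ {u v b} → Closes u v b → w′ u v ≡ 0ℚ → z u v ≡ 0ℚ
    w′≡0⇒z≡0 c e = trans (proj₂ (to (closed⇔ rightOdd) (rightClosed c))) (trans
      (cong (λ s → - (κ′ * s + κ′ * s)) e) (solve 1 (λ s → :- (s :* con 0ℚ :+ s :* con 0ℚ) := con 0ℚ) refl κ′))

    z≡0⇒w′≡0 : IsUnit κ′ → ∀ {u v b} → Closes u v b → z u v ≡ 0ℚ → w′ u v ≡ 0ℚ
    z≡0⇒w′≡0 κ′-unit {u} {v} c e = unit-cancel-zero κ′-unit (double-zero (trans
      (solve 1 (λ s → s := :- (:- s)) refl (κ′ * w′ u v + κ′ * w′ u v))
      (cong -_ (trans (sym (proj₂ (to (closed⇔ rightOdd) (rightClosed c)))) e))))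

    right-zero : ∀ {Z W b} → Z ≡ 0ℚ → W ≡ 0ℚ → b ≡ 0ℚ → RightClosed Z W b
    right-zero refl refl refl = from (closed⇔ rightOdd) (sym (*-zeroʳ κ′) ,
      solve 1 (λ s → con 0ℚ := :- (s :* con 0ℚ :+ s :* con 0ℚ)) refl κ′)

  odd-w≡0 : ∀ {κ} → LeftOdd κ → ∀ {u v b} → Closes u v b → w u v ≡ 0ℚ → u ≡ 0ℚ × v ≡ 0ℚ
  odd-w≡0 left c e = LeftOdd.w≡0⇒u≡0 left e , LeftOdd.w≡0⇒v≡0 left (leftClosed c) e

  odd-g≡0⇒w≡0 : ∀ {κ} → LeftOdd κ → ∀ {u v b} → Closes u v b → g u v ≡ 0ℚ → w u v ≡ 0ℚ
  odd-g≡0⇒w≡0 left c e = unit-cancel-zero (LeftOdd.κ-unit left)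
    (double-zero (trans (sym (LeftOdd.g≡2κw left (leftClosed c))) e))

  odd-w≡0⇒g≡0 : ∀ {κ} → LeftOdd κ → ∀ {u v b} → Closes u v b → w u v ≡ 0ℚ → g u v ≡ 0ℚ
  odd-w≡0⇒g≡0 {κ} left c e = trans (LeftOdd.g≡2κw left (leftClosed c)) (trans
    (cong (λ s → κ * s + κ * s) e) (solve 1 (λ s → s :* con 0ℚ :+ s :* con 0ℚ := con 0ℚ) refl κ))

  unmatched-b≡0 : RightUnmatched → ∀ {u v b} → Closes u v b → z u v ≡ 0ℚ → b ≡ 0ℚ
  unmatched-b≡0 right {u} {v} {b} c e = double-zero (trans
    (trans (sym (+-identityˡ (b + b))) (cong (_+ (b + b)) (sym e))) (proj₂ (to right (rightClosed c))))

  unmatched-b≡0⇒z≡0 : RightUnmatched → ∀ {u v} → Closes u v 0ℚ → z u v ≡ 0ℚ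
  unmatched-b≡0⇒z≡0 right c = trans (sym (+-identityʳ _)) (proj₂ (to right (rightClosed c)))

  unmatched-w′≡0 : RightUnmatched → ∀ {u v b} → Closes u v b → w′ u v ≡ 0ℚ
  unmatched-w′≡0 right c = proj₁ (to right (rightClosed c))

  matched-z≡0 : RightMatched → ∀ {u v b} → Closes u v b → z u v ≡ 0ℚ
  matched-z≡0 right c = to right (rightClosed c)

  zero-w : w 0ℚ 0ℚ ≡ 0ℚ
  zero-w = alt-zero P

  zero-closed : LeftClosed 0ℚ 0ℚ
  zero-closed = trans (cong (λ s → 0ℚ + α * s) zero-w) (trans (+-identityˡ _) (*-zeroʳ α))

  zero-g : g 0ℚ 0ℚ ≡ 0ℚ
  zero-g = trans (cong₂ _+_ (alt-zero m) (*-zeroʳ α)) (+-identityʳ 0ℚ)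

  -- The lines have slopes 2 and -2 up to sign, and the exchange of components turns 2 into one
  -- half; they never coincide, and substitution yields `fixed` with its factor 4.
  odd-odd-crossed : ∀ {κ κ′} → IsUnit κ′ → LeftOdd κ → RightOdd κ′ → Crossed → Nullity matrix 0
  odd-odd-crossed {κ} {κ′} κ′-unit left right mid = nullity₀ (λ u v b c →
    let open Crossed mid
        open ≡-Reasoning
        fixed : s * w u v ≡ κ * κ′ * ((s * w u v + s * w u v) + (s * w u v + s * w u v))
        fixed = begin
          s * w u v                               ≡⟨ z≡sw u v ⟨
          z u v                                   ≡⟨ proj₂ (to (closed⇔ right) (rightClosed c)) ⟩
          - (κ′ * w′ u v + κ′ * w′ u v)           ≡⟨ cong (λ x → - (κ′ * x + κ′ * x)) (trans (w′≡-sg u v)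
                                                       (cong (- s *_) (LeftOdd.g≡2κw left (leftClosed c)))) ⟩
          - (κ′ * (- s * (κ * w u v + κ * w u v)) + κ′ * (- s * (κ * w u v + κ * w u v)))
            ≡⟨ solve 4 (λ k l s w → :- (l :* ((:- s) :* (k :* w :+ k :* w)) :+ l :* ((:- s) :* (k :* w :+ k :* w)))
                 := k :* l :* ((s :* w :+ s :* w) :+ (s :* w :+ s :* w))) refl κ κ′ s (w u v) ⟩
          κ * κ′ * ((s * w u v + s * w u v) + (s * w u v + s * w u v)) ∎
        w≡0 = unit-cancel-zero s-unit (four-fold-fixed (unit-* (LeftOdd.κ-unit left) κ′-unit) fixed)
        u≡0 , v≡0 = odd-w≡0 left c w≡0
    in u≡0 , v≡0 , w′≡0⇒b≡0 right c (g≡0⇒w′≡0 (odd-w≡0⇒g≡0 left c w≡0)))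

  -- With equal `κ` the left cycle gives slope `2κ` and the right one `-2κ`, so the lines meet only
  -- in the origin.
  odd-odd-balanced : ∀ {κ} → LeftOdd κ → RightOdd κ → Straight → Nullity matrix 0
  odd-odd-balanced {κ} left right mid = nullity₀ (λ u v b c →
    let open Straight mid
        open ≡-Reasoning
        x = s * (κ * w u v)
        negated : x + x ≡ - (x + x)
        negated = begin
          x + x                          ≡⟨ *-distribˡ-+ s (κ * w u v) (κ * w u v) ⟨
          s * (κ * w u v + κ * w u v)    ≡⟨ cong (s *_) (LeftOdd.g≡2κw left (leftClosed c)) ⟨
          s * g u v                      ≡⟨ z≡sg u v ⟨
          z u v                          ≡⟨ proj₂ (to (closed⇔ right) (rightClosed c)) ⟩
          - (κ * w′ u v + κ * w′ u v)    ≡⟨ cong (λ y → - (κ * y + κ * y)) (w′≡sw u v) ⟩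
          - (κ * (s * w u v) + κ * (s * w u v))
            ≡⟨ solve 3 (λ s k w → :- (k :* (s :* w) :+ k :* (s :* w)) := :- (s :* (k :* w) :+ s :* (k :* w))) refl s κ (w u v) ⟩
          - (x + x) ∎
        w≡0 = unit-cancel-zero (LeftOdd.κ-unit left) (unit-cancel-zero s-unit (double-zero {x} (double-zero {x + x}
          (trans (cong ((x + x) +_) negated) (+-inverseʳ (x + x))))))
        u≡0 , v≡0 = odd-w≡0 left c w≡0
    in u≡0 , v≡0 , w′≡0⇒b≡0 right c (w≡0⇒w′≡0 w≡0))

  -- Opposite `κ` make the two lines coincide; the kernel is this line, with coordinate `u`.
  odd-odd-unbalanced : ∀ {κ} → LeftOdd κ → RightOdd (- κ) → Straight → Nullity matrix 1
  odd-odd-unbalanced {κ} left right mid = nullity₁-u (LeftOdd.partner left) (- κ * w′ 1ℚ v₁)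
    (closes (LeftOdd.closed left) (from (closed⇔ right) (refl , z≡)))
    (λ v b c → let w≡0 = LeftOdd.u≡0⇒w≡0 left refl in
      proj₂ (odd-w≡0 left c w≡0) , w′≡0⇒b≡0 right c (w≡0⇒w′≡0 w≡0))
    where
    open Straight mid
    open ≡-Reasoning
    v₁ = LeftOdd.partner left
    z≡ : z 1ℚ v₁ ≡ - (- κ * w′ 1ℚ v₁ + - κ * w′ 1ℚ v₁)
    z≡ = begin
      z 1ℚ v₁                             ≡⟨ z≡sg 1ℚ v₁ ⟩
      s * g 1ℚ v₁                         ≡⟨ cong (s *_) (LeftOdd.g≡2κw left (LeftOdd.closed left)) ⟩
      s * (κ * w 1ℚ v₁ + κ * w 1ℚ v₁)     ≡⟨ solve 3 (λ s k w → s :* (k :* w :+ k :* w) :=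
                                               :- ((:- k) :* (s :* w) :+ (:- k) :* (s :* w))) refl s κ (w 1ℚ v₁) ⟩
      - (- κ * (s * w 1ℚ v₁) + - κ * (s * w 1ℚ v₁)) ≡⟨ cong (λ y → - (- κ * y + - κ * y)) (w′≡sw 1ℚ v₁) ⟨
      - (- κ * w′ 1ℚ v₁ + - κ * w′ 1ℚ v₁) ∎

  Middle : Set
  Middle = Straight ⊎ Crossed

  middle-zero : Middle → ∀ {u v} → w u v ≡ 0ℚ → g u v ≡ 0ℚ → z u v ≡ 0ℚ × w′ u v ≡ 0ℚ
  middle-zero (inj₁ mid) w≡0 g≡0 = Straight.g≡0⇒z≡0 mid g≡0 , Straight.w≡0⇒w′≡0 mid w≡0
  middle-zero (inj₂ mid) w≡0 g≡0 = Crossed.w≡0⇒z≡0 mid w≡0 , Crossed.g≡0⇒w′≡0 mid g≡0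

  middle-w≡0 : Middle → ∀ {u v} → z u v ≡ 0ℚ → w′ u v ≡ 0ℚ → w u v ≡ 0ℚ
  middle-w≡0 (inj₁ mid) z≡0 w′≡0 = Straight.w′≡0⇒w≡0 mid w′≡0
  middle-w≡0 (inj₂ mid) z≡0 w′≡0 = Crossed.z≡0⇒w≡0 mid z≡0

  middle-g≡0 : Middle → ∀ {u v} → z u v ≡ 0ℚ → w′ u v ≡ 0ℚ → g u v ≡ 0ℚ
  middle-g≡0 (inj₁ mid) z≡0 w′≡0 = Straight.z≡0⇒g≡0 mid z≡0
  middle-g≡0 (inj₂ mid) z≡0 w′≡0 = Crossed.w′≡0⇒g≡0 mid w′≡0

  matched-closes-u : LeftMatched → Middle → (∀ {Z W b} → Z ≡ 0ℚ → W ≡ 0ℚ → b ≡ 0ℚ → RightClosed Z W b) →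
    Closes 1ℚ 0ℚ 0ℚ
  matched-closes-u left mid right = closes (LeftMatched.closed left 1ℚ 0ℚ) (right z≡0 w′≡0 refl)
    where
    zeros = middle-zero mid (LeftMatched.w≡0 left 1ℚ) (LeftMatched.g≡0 left 1ℚ 0ℚ)
    z≡0 = proj₁ zeros
    w′≡0 = proj₂ zeros

  matched-closes-b : RightMatched → Middle → Closes 0ℚ 0ℚ 1ℚ
  matched-closes-b right mid = closes zero-closed (from right (proj₁ (middle-zero mid zero-w zero-g)))

  -- The left line is a coordinate axis and so is its image under either transport, whereas the line
  -- of an odd cycle meets both axes only in the origin.
  unmatched-odd : ∀ {κ} → IsUnit κ → LeftUnmatched → RightOdd κ → Middle → Nullity matrix 0
  unmatched-odd {κ} κ-unit left right mid = nullity₀ (λ u v b c →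
    let w≡0 = LeftUnmatched.left-w≡0 left (leftClosed c)
        z≡0 , w′≡0 = ends mid c w≡0
    in LeftUnmatched.g≡0⇒u≡0 left (middle-g≡0 mid z≡0 w′≡0) ,
       LeftUnmatched.v≡0 left (leftClosed c) , w′≡0⇒b≡0 right c w′≡0)
    where
    ends : Middle → ∀ {u v b} → Closes u v b → w u v ≡ 0ℚ → z u v ≡ 0ℚ × w′ u v ≡ 0ℚ
    ends (inj₁ m) c w≡0 = let w′≡0 = Straight.w≡0⇒w′≡0 m w≡0 in w′≡0⇒z≡0 right c w′≡0 , w′≡0
    ends (inj₂ m) c w≡0 = let z≡0 = Crossed.w≡0⇒z≡0 m w≡0 in z≡0 , z≡0⇒w′≡0 right κ-unit c z≡0

  -- Again an axis against an oblique line, so the path carries only zeros; what survives is `u`,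
  -- the kernel vector living on the first cycle alone.
  matched-odd : ∀ {κ} → IsUnit κ → LeftMatched → RightOdd κ → Middle → Nullity matrix 1
  matched-odd {κ} κ-unit left right mid = nullity₁-u 0ℚ 0ℚ (matched-closes-u left mid (right-zero right))
    (λ v b c → let z≡0 , w′≡0 = ends mid c (LeftMatched.g≡0 left 0ℚ v) in
      LeftMatched.w≡0⇒v≡0 left (middle-w≡0 mid z≡0 w′≡0) , w′≡0⇒b≡0 right c w′≡0)
    where
    ends : Middle → ∀ {u v b} → Closes u v b → g u v ≡ 0ℚ → z u v ≡ 0ℚ × w′ u v ≡ 0ℚ
    ends (inj₁ m) c g≡0 = let z≡0 = Straight.g≡0⇒z≡0 m g≡0 in z≡0 , z≡0⇒w′≡0 right κ-unit c z≡0
    ends (inj₂ m) c g≡0 = let w′≡0 = Crossed.g≡0⇒w′≡0 m g≡0 in w′≡0⇒z≡0 right c w′≡0 , w′≡0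

  odd-unmatched : ∀ {κ} → LeftOdd κ → RightUnmatched → Middle → Nullity matrix 0
  odd-unmatched left right mid = nullity₀ (λ u v b c →
    let w≡0 = w-zero mid c (unmatched-w′≡0 right c)
        u≡0 , v≡0 = odd-w≡0 left c w≡0
    in u≡0 , v≡0 , unmatched-b≡0 right c (proj₁ (middle-zero mid w≡0 (odd-w≡0⇒g≡0 left c w≡0))))
    where
    w-zero : Middle → ∀ {u v b} → Closes u v b → w′ u v ≡ 0ℚ → w u v ≡ 0ℚ
    w-zero (inj₁ m) c w′≡0 = Straight.w′≡0⇒w≡0 m w′≡0
    w-zero (inj₂ m) c w′≡0 = odd-g≡0⇒w≡0 left c (Crossed.w′≡0⇒g≡0 m w′≡0)

  -- The mirror image of `matched-odd`: the surviving vector lives on the second cycle, with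
  -- coordinate `b`.
  odd-matched : ∀ {κ} → LeftOdd κ → RightMatched → Middle → Nullity matrix 1
  odd-matched left right mid = nullity₁-b (matched-closes-b right mid)
    (λ u v c → odd-w≡0 left c (w-zero mid c (matched-z≡0 right c)))
    where
    w-zero : Middle → ∀ {u v b} → Closes u v b → z u v ≡ 0ℚ → w u v ≡ 0ℚ
    w-zero (inj₁ m) c z≡0 = odd-g≡0⇒w≡0 left c (Straight.z≡0⇒g≡0 m z≡0)
    w-zero (inj₂ m) c z≡0 = Crossed.z≡0⇒w≡0 m z≡0

  unmatched-zero : RightUnmatched → ∀ {Z W b} → Z ≡ 0ℚ → W ≡ 0ℚ → b ≡ 0ℚ → RightClosed Z W b
  unmatched-zero right refl refl refl = from right (refl , refl)

  matched-zero : RightMatched → ∀ {Z W b} → Z ≡ 0ℚ → W ≡ 0ℚ → b ≡ 0ℚ → RightClosed Z W b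
  matched-zero right Z≡0 _ _ = from right Z≡0

  -- Both lines are the axis on which `g` vanishes, and each cycle adds a parameter, so every triple
  -- is a solution.
  matched-matched-straight : LeftMatched → RightMatched → Straight → Nullity matrix 3
  matched-matched-straight left right mid = nullity₃ (closed 1ℚ 0ℚ 0ℚ) (closed 0ℚ 1ℚ 0ℚ) (closed 0ℚ 0ℚ 1ℚ)
    where
    closed : ∀ u v b → Closes u v b
    closed u v b = closes (LeftMatched.closed left u v)
      (from right (Straight.g≡0⇒z≡0 mid (LeftMatched.g≡0 left u v)))

  matched-unmatched-straight : LeftMatched → RightUnmatched → Straight → Nullity matrix 1
  matched-unmatched-straight left right mid = nullity₁-u 0ℚ 0ℚ
    (matched-closes-u left (inj₁ mid) (unmatched-zero right))
    (λ v b c → LeftMatched.w≡0⇒v≡0 left (Straight.w′≡0⇒w≡0 mid (unmatched-w′≡0 right c)) ,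
      unmatched-b≡0 right c (Straight.g≡0⇒z≡0 mid (LeftMatched.g≡0 left 0ℚ v)))

  unmatched-matched-straight : LeftUnmatched → RightMatched → Straight → Nullity matrix 1
  unmatched-matched-straight left right mid = nullity₁-b (matched-closes-b right (inj₁ mid))
    (λ u v c → LeftUnmatched.g≡0⇒u≡0 left (Straight.z≡0⇒g≡0 mid (matched-z≡0 right c)) ,
      LeftUnmatched.v≡0 left (leftClosed c))

  -- Both lines are the axis `w = 0`; it contributes one dimension, and the cycles contribute none.
  unmatched-unmatched-straight : LeftUnmatched → RightUnmatched → Straight → Nullity matrix 1
  unmatched-unmatched-straight left right mid = nullity₁-u 0ℚ b
    (closes (LeftUnmatched.closed left 1ℚ) (from right (Straight.w≡0⇒w′≡0 mid (LeftUnmatched.w≡0 left 1ℚ) ,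
      solve 1 (λ z → z :+ (:- (con ½ :* z) :+ :- (con ½ :* z)) := con 0ℚ) refl (z 1ℚ 0ℚ))))
    (λ v b c → LeftUnmatched.v≡0 left (leftClosed c) ,
      unmatched-b≡0 right c (Straight.g≡0⇒z≡0 mid (LeftUnmatched.u≡0⇒g≡0 left refl)))
    -- Solves `Z + (b + b) ≡ 0ℚ` for `b`.
    where b = - (½ * z 1ℚ 0ℚ)

  matched-matched-crossed : LeftMatched → RightMatched → Crossed → Nullity matrix 2
  matched-matched-crossed left right mid = nullity₂ 0ℚ
    (matched-closes-u left (inj₂ mid) (matched-zero right)) (matched-closes-b right (inj₂ mid))
    (λ v c → LeftMatched.w≡0⇒v≡0 left (Crossed.z≡0⇒w≡0 mid (matched-z≡0 right c)))

  -- The quarter turn makes the axes `g = 0` and `W = 0` coincide: one dimension from the common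
  -- line, one from `u`.
  matched-unmatched-crossed : LeftMatched → RightUnmatched → Crossed → Nullity matrix 2
  matched-unmatched-crossed left right mid = nullity₂ v₁
    (matched-closes-u left (inj₂ mid) (unmatched-zero right))
    (closes (LeftMatched.closed left 0ℚ v₁) (from right
      (Crossed.g≡0⇒w′≡0 mid (LeftMatched.g≡0 left 0ℚ v₁) , z≡)))
    (λ v c → LeftMatched.w≡0⇒v≡0 left (Crossed.z≡0⇒w≡0 mid (unmatched-b≡0⇒z≡0 right c)))
    where
    open Crossed mid
    open LeftMatched left
    -- For `b = 1` the value `z` must be -2, and `z` is `s * (δ * v)` with self-inverse factors.
    v₁ = - (δ * (s * (1ℚ + 1ℚ)))
    z≡ : z 0ℚ v₁ + (1ℚ + 1ℚ) ≡ 0ℚ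
    z≡ = trans (cong (_+ (1ℚ + 1ℚ)) (trans (z≡sw 0ℚ v₁) (trans (cong (s *_) (w≡δv 0ℚ v₁))
      (trans (solve 3 (λ s d t → s :* (d :* (:- (d :* (s :* t)))) := :- (s :* (d :* (d :* (s :* t))))) refl s δ (1ℚ + 1ℚ))
        (cong -_ (trans (cong (s *_) (unit-cancelˡ δ-unit (s * (1ℚ + 1ℚ)))) (unit-cancelˡ s-unit (1ℚ + 1ℚ))))))))
      refl

  unmatched-matched-crossed : LeftUnmatched → RightMatched → Crossed → Nullity matrix 2
  unmatched-matched-crossed left right mid = nullity₂ 0ℚ
    (closes (LeftUnmatched.closed left 1ℚ) (from right (Crossed.w≡0⇒z≡0 mid (LeftUnmatched.w≡0 left 1ℚ))))
    (matched-closes-b right (inj₂ mid))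
    (λ v c → LeftUnmatched.v≡0 left (leftClosed c))

  -- The axes `w = 0` and, after the quarter turn, `g = 0` meet only in the origin.
  unmatched-unmatched-crossed : LeftUnmatched → RightUnmatched → Crossed → Nullity matrix 0
  unmatched-unmatched-crossed left right mid = nullity₀ (λ u v b c →
    LeftUnmatched.g≡0⇒u≡0 left (Crossed.w′≡0⇒g≡0 mid (unmatched-w′≡0 right c)) ,
    LeftUnmatched.v≡0 left (leftClosed c) ,
    unmatched-b≡0 right c (Crossed.w≡0⇒z≡0 mid (LeftUnmatched.left-w≡0 left (leftClosed c))))

-- Parity arithmetic

NullityAtLeast-pred : ∀ {n} {A : Matrix n} {k} → NullityAtLeast A (suc k) → NullityAtLeast A k
NullityAtLeast-pred (v , ker , indep) = v ∘ F.suc , ker ∘ F.suc , λ c comb t →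
  indep (0ℚ ∷ c) (λ j → trans (cong₂ _+_ (*-zeroˡ (v F.zero j)) (comb j)) (+-identityˡ 0ℚ)) (F.suc t)

Nullity-cong : ∀ {n} {A B : Matrix n} → (∀ i j → A i j ≡ B i j) → ∀ {k} → Nullity A k → Nullity B k
Nullity-cong A≗B (≥k , ≱1+k) =
  NullityAtLeast-cong A≗B ≥k , ≱1+k ∘ NullityAtLeast-cong (λ i j → sym (A≗B i j))

sg-+ : ∀ m n → sg (m ℕ.+ n) ≡ sg m * sg n
sg-+ zero    n = sym (*-identityˡ (sg n))
sg-+ (suc m) n = trans (cong -_ (sg-+ m n)) (neg-distribˡ-* (sg m) (sg n))

sg-double : ∀ h → sg (h ℕ.* 2) ≡ 1ℚ
sg-double zero    = refl
sg-double (suc h) = trans (solve 1 (λ s → :- (:- s) := s) refl (sg (h ℕ.* 2))) (sg-double h)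

sg-even : ∀ n → n % 2 ≡ 0 → sg n ≡ 1ℚ
sg-even n e = trans (cong sg (trans (m≡m%n+[m/n]*n n 2) (cong (ℕ._+ n / 2 ℕ.* 2) e))) (sg-double (n / 2))

sg-odd : ∀ n → n % 2 ≡ 1 → sg n ≡ - 1ℚ
sg-odd n e = trans (cong sg (trans (m≡m%n+[m/n]*n n 2) (cong (ℕ._+ n / 2 ℕ.* 2) e))) (cong -_ (sg-double (n / 2)))

sg-⊖ : ∀ m n → sg ∣ m ⊖ n ∣ ≡ sg m * sg n
sg-⊖ zero    zero    = refl
sg-⊖ zero    (suc n) = sym (*-identityˡ (sg (suc n)))
sg-⊖ (suc m) zero    = solve 1 (λ s → :- s := :- s :* con 1ℚ) refl (sg m)
sg-⊖ (suc m) (suc n) = trans (cong (λ i → sg ∣ i ∣) (ℤ.[1+m]⊖[1+n]≡m⊖n m n)) (trans (sg-⊖ m n)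
  (solve 2 (λ s t → s :* t := (:- s) :* (:- t)) refl (sg m) (sg n)))

-- Modulo 2 subtraction is addition. The grouping pairs the count of negative edges of each cycle
-- with half its length, so that the two factors become the `κ` of the left and of the right cycle.
sg-difference : ∀ a b c d → sg ∣ ((ℤ.+ a) - (ℤ.+ b)) +ℤ ((ℤ.+ c) - (ℤ.+ d)) ∣ ≡ (sg a * sg d) * (sg b * sg c)
sg-difference a b c d = trans (cong (λ i → sg ∣ i ∣) regroup) (trans (sg-⊖ (a ℕ.+ c) (b ℕ.+ d))
  (trans (cong₂ _*_ (sg-+ a c) (sg-+ b d))
    (solve 4 (λ a b c d → a :* c :* (b :* d) := (a :* d) :* (b :* c)) refl (sg a) (sg b) (sg c) (sg d))))
  where
  rearrange : ∀ i j k l → (i - j) +ℤ (k - l) ≡ (i +ℤ k) - (j +ℤ l)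
  rearrange = ℤ-Solver.solve-∀
  regroup : ((ℤ.+ a) - (ℤ.+ b)) +ℤ ((ℤ.+ c) - (ℤ.+ d)) ≡ (a ℕ.+ c) ⊖ (b ℕ.+ d)
  regroup = trans (rearrange (ℤ.+ a) (ℤ.+ b) (ℤ.+ c) (ℤ.+ d)) (ℤ.m-n≡m⊖n (a ℕ.+ c) (b ℕ.+ d))

even-half : ∀ m → suc (suc m) % 2 ≡ 0 → ∃ λ h → m ≡ h ℕ.* 2
even-half m e with suc (suc m) / 2 | trans (m≡m%n+[m/n]*n (suc (suc m)) 2) (cong (ℕ._+ suc (suc m) / 2 ℕ.* 2) e)
... | suc h | eq = h , ℕ.suc-injective (ℕ.suc-injective eq)

odd-half : ∀ m → suc (suc m) % 2 ≡ 1 → ∃ λ h → m ≡ suc (h ℕ.* 2) × suc (suc m) / 2 ≡ suc h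
odd-half m e with suc (suc m) / 2 | trans (m≡m%n+[m/n]*n (suc (suc m)) 2) (cong (ℕ._+ suc (suc m) / 2 ℕ.* 2) e)
... | suc h | eq = h , ℕ.suc-injective (ℕ.suc-injective eq) , refl

odd-pred : ∀ L → suc L % 2 ≡ 1 → ∃ λ h → L ≡ h ℕ.* 2
odd-pred L e = suc L / 2 , ℕ.suc-injective (trans (m≡m%n+[m/n]*n (suc L) 2) (cong (ℕ._+ suc L / 2 ℕ.* 2) e))

even-pred : ∀ L → suc L % 2 ≡ 0 → ∃ λ h → L ≡ suc (h ℕ.* 2)
even-pred L e with suc L / 2 | trans (m≡m%n+[m/n]*n (suc L) 2) (cong (ℕ._+ suc L / 2 ℕ.* 2) e)
... | suc h | eq = h , ℕ.suc-injective eq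

-- Counting negative edges of a cycle

sumℕ-cong : ∀ n {f g : ℕ → ℕ} → (∀ i → i < n → f i ≡ g i) → sumℕ n f ≡ sumℕ n g
sumℕ-cong zero    e = refl
sumℕ-cong (suc n) e = cong₂ ℕ._+_ (sumℕ-cong n (λ i i<n → e i (ℕ.m≤n⇒m≤1+n i<n))) (e n ℕ.≤-refl)

sumℕ-zero : ∀ n {f : ℕ → ℕ} → (∀ i → i < n → f i ≡ 0) → sumℕ n f ≡ 0
sumℕ-zero zero    e = refl
sumℕ-zero (suc n) e = cong₂ ℕ._+_ (sumℕ-zero n (λ i i<n → e i (ℕ.m≤n⇒m≤1+n i<n))) (e n ℕ.≤-refl)

sumℕ-head : ∀ n {f : ℕ → ℕ} → (∀ i → i < n → f (suc i) ≡ 0) → sumℕ (suc n) f ≡ f 0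
sumℕ-head zero    e = refl
sumℕ-head (suc n) e = trans (cong₂ ℕ._+_ (sumℕ-head n (λ i i<n → e i (ℕ.m≤n⇒m≤1+n i<n)))
  (e n ℕ.≤-refl)) (ℕ.+-identityʳ _)

sg-isNeg : ∀ s → sg (b2n (isNeg s)) ≡ sgn s
sg-isNeg pos = refl
sg-isNeg neg = refl

module CycleSign (m : ℕ) (1≤m : 1 ≤ m) (τ : ℕ → ℕ → Sign) (τ-sym : Symmetric τ) where

  open Cycle m 1≤m τ τ-sym public

  negative : ℕ → ℕ → ℕ
  negative b a = b2n (pathAnd closing a b ∧ isNeg (τ a b))

  negatives : ℕ
  negatives = sumℕ (suc (suc m)) (λ b → sumℕ b (negative b))

  private
    consecutive : ∀ a → negative (suc a) a ≡ b2n (isNeg (τ a (suc a)))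
    consecutive a = cong (λ t → b2n ((t ∨ (suc (suc a) == a) ∨ closing a (suc a)) ∧ isNeg (τ a (suc a)))) (==-refl (suc a))

    skip : ∀ a b → a < b → (closing a (suc b) ≡ false) → negative (suc b) a ≡ 0
    skip a b a<b e = cong (λ t → b2n (t ∧ isNeg (τ a (suc b)))) (trans
      (cong₂ (λ s t → s ∨ t ∨ closing a (suc b)) (≢⇒== (ℕ.<⇒≢ (s≤s a<b)))
        (≢⇒== (λ e → ℕ.<⇒≢ (ℕ.<-trans a<b (ℕ.≤-trans (ℕ.n<1+n b) (ℕ.n≤1+n (suc b)))) (sym e)))) e)

    closing-pair : ∀ a b → closing a (suc b) ≡ ((a == 0) ∧ (suc b == suc m))
    closing-pair a b = trans (cong (((a == 0) ∧ (suc b == suc m)) ∨_) (∧-zeroʳ (a == suc m))) (∨-identityʳ _)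

    inner : ∀ b → b < m → sumℕ (suc b) (negative (suc b)) ≡ b2n (isNeg (τ b (suc b)))
    inner b b<m = cong₂ ℕ._+_ (sumℕ-zero b (λ a a<b → skip a b a<b (trans (closing-pair a b)
      (trans (cong ((a == 0) ∧_) (≢⇒== (ℕ.<⇒≢ (s≤s b<m)))) (∧-zeroʳ (a == 0)))))) (consecutive b)

    -- Writing `m` as a successor exposes the entry at 0, where the closing edge sits; the other
    -- entries of this range are no edges.
    last-inner : ∀ m′ → m ≡ suc m′ → sumℕ m (negative (suc m)) ≡ b2n (isNeg (τ 0 (suc m)))
    last-inner m′ m≡ = trans (cong (λ i → sumℕ i (negative (suc m))) m≡)
      (trans (sumℕ-head m′ (λ a a<m′ → skip (suc a) m (subst (suc a <_) (sym m≡) (s≤s a<m′)) (closing-pair (suc a) m)))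
      (cong (λ t → b2n (t ∧ isNeg (τ 0 (suc m)))) (cong₂ (λ s t → s ∨ false ∨ t)
        (≢⇒== (ℕ.<⇒≢ (s≤s 1≤m))) (trans (closing-pair 0 m) (==-refl (suc m))))))

    partial : ∀ j → j ≤ m → sg (sumℕ (suc j) (λ b → sumℕ b (negative b))) ≡ pathSign τ j
    partial zero    _   = refl
    partial (suc j) j<m = trans (sg-+ (sumℕ (suc j) (λ b → sumℕ b (negative b))) (sumℕ (suc j) (negative (suc j))))
      (cong₂ _*_ (partial j (ℕ.<⇒≤ j<m)) (trans (cong sg (inner j j<m)) (sg-isNeg (τ j (suc j)))))

  -- Each edge is counted at its larger endpoint: the vertices up to `m` contribute the path edges
  -- in front of them, and the last vertex contributes a path edge and the closing edge.
  sg-negatives : sg negatives ≡ γ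
  sg-negatives = trans (sg-+ (sumℕ (suc m) (λ b → sumℕ b (negative b))) (sumℕ (suc m) (negative (suc m))))
    (trans (cong₂ _*_ (partial m ℕ.≤-refl) (trans (sg-+ (sumℕ m (negative (suc m))) (negative (suc m) m))
      (cong₂ _*_
        (trans (cong sg (last-inner (ℕ.pred m) (sym (ℕ.suc-pred m ⦃ ℕ.>-nonZero 1≤m ⦄)))) (sg-isNeg (τ 0 (suc m))))
        (trans (cong sg (consecutive m)) (sg-isNeg (τ m (suc m)))))))
    (solve 3 (λ d s t → d :* (s :* t) := s :* (con 1ℚ :* (d :* t))) refl
      (pathSign τ m) (sgn (τ 0 (suc m))) (sgn (τ m (suc m)))))

  module _ (h : ℕ) (m≡ : m ≡ h ℕ.* 2) where
    private
      alt-m : ∀ u v → alt m u v ≡ sg h * u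
      alt-m u v = trans (cong (λ i → alt i u v) m≡) (alt-even h u v)
      alt-1+m : ∀ u v → alt (suc m) u v ≡ sg h * v
      alt-1+m u v = trans (cong (λ i → alt (suc i) u v) m≡) (alt-odd h u v)

    matched-singular : γ ≡ - sg h → NullityAtLeast cycle 1
    matched-singular γ≡ = cycle-singular 1ℚ 0ℚ (λ ())
      (trans (cong (λ s → 0ℚ + γ * s) (alt-1+m 1ℚ 0ℚ))
        (solve 2 (λ c s → con 0ℚ :+ c :* (s :* con 0ℚ) := con 0ℚ) refl γ (sg h)))
      (trans (cong₂ (λ s t → s + t * 1ℚ) (alt-m 1ℚ 0ℚ) γ≡)
        (solve 1 (λ s → s :* con 1ℚ :+ (:- s) :* con 1ℚ := con 0ℚ) refl (sg h)))

    unmatched-regular : γ ≡ sg h → ¬ NullityAtLeast cycle 1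
    unmatched-regular γ≡ = cycle-trivial (λ u v eˡ eʳ →
      unit-cancel-zero (sg-unit h) (double-zero (trans (cong₂ (λ s t → s + t * u) (sym (alt-m u v)) (sym γ≡)) eʳ)) ,
      double-zero (trans (cong (v +_) (trans (sym (unit-cancelˡ (sg-unit h) v))
        (cong₂ _*_ (sym γ≡) (sym (alt-1+m u v))))) eˡ))

    nullity-0⇒unmatched : Nullity cycle 0 → γ ≡ sg h
    nullity-0⇒unmatched (_ , ≱1) with unit-dichotomy γ-unit (sg-unit h)
    ... | inj₁ γ≡ = γ≡
    ... | inj₂ γ≡ = contradiction (matched-singular γ≡) ≱1

    -- Only two signs are possible, and for the other one the cycle has no nonzero kernel vector; a
    -- single vector out of the two decides.
    nullity-2⇒matched : Nullity cycle 2 → γ ≡ - sg h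
    nullity-2⇒matched (≥2 , _) with unit-dichotomy γ-unit (sg-unit h)
    ... | inj₁ γ≡ = contradiction (NullityAtLeast-pred {A = cycle} ≥2) (unmatched-regular γ≡)
    ... | inj₂ γ≡ = γ≡

-- Relabelling the second cycle from zero

shift : ℕ → (ℕ → ℕ → Sign) → ℕ → ℕ → Sign
shift c τ a b = τ (c ℕ.+ a) (c ℕ.+ b)

pathSign-shift : ∀ τ c j → pathSign τ (c ℕ.+ j) ≡ pathSign τ c * pathSign (shift c τ) j
pathSign-shift τ c zero    = trans (cong (pathSign τ) (ℕ.+-identityʳ c)) (sym (*-identityʳ _))
pathSign-shift τ c (suc j) = trans (cong (pathSign τ) (ℕ.+-suc c j)) (trans
  (cong₂ _*_ (pathSign-shift τ c j) (cong (λ i → sgn (τ (c ℕ.+ j) i)) (sym (ℕ.+-suc c j))))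
  (*-assoc (pathSign τ c) (pathSign (shift c τ) j) (sgn (shift c τ j (suc j)))))

-- The signs in front of `c` enter both `pathSign` factors and cancel, so the sign of a cycle does
-- not depend on where the path starts.
chordSign-shift : ∀ τ c j → chordSign τ c (c ℕ.+ j) ≡ chordSign (shift c τ) 0 j
chordSign-shift τ c j = trans (cong₂ (λ i s → sgn (τ i (c ℕ.+ j)) * (pathSign τ c * s))
    (sym (ℕ.+-identityʳ c)) (pathSign-shift τ c j))
  (cong (sgn (shift c τ 0 j) *_) (trans (unit-cancelˡ (pathSign-unit τ c) _) (sym (*-identityˡ _))))

==-shift : ∀ c a b → ((c ℕ.+ a) == (c ℕ.+ b)) ≡ (a == b)
==-shift zero    a b = refl
==-shift (suc c) a b = trans (==-suc (c ℕ.+ a) (c ℕ.+ b)) (==-shift c a b)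

==-shift-0 : ∀ c a → ((c ℕ.+ a) == c) ≡ (a == 0)
==-shift-0 c a = trans (cong ((c ℕ.+ a) ==_) (sym (ℕ.+-identityʳ c))) (==-shift c a 0)

isPair-shift : ∀ c a b d → isPair (c ℕ.+ a) (c ℕ.+ b) c (c ℕ.+ d) ≡ isPair a b 0 d
isPair-shift c a b d = cong₂ _∨_
  (cong₂ _∧_ (==-shift-0 c a) (==-shift c b d)) (cong₂ _∧_ (==-shift c a d) (==-shift-0 c b))

isPair-none : ∀ {a b c d} → a ≢ d → b ≢ d → isPair a b c d ≡ false
isPair-none {a} {b} {c} {d} a≢d b≢d = cong₂ _∨_
  (trans (cong ((a == c) ∧_) (≢⇒== b≢d)) (∧-zeroʳ (a == c))) (cong (_∧ (b == c)) (≢⇒== a≢d))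

isPair-comm : ∀ a b c d → isPair a b c d ≡ isPair a b d c
isPair-comm a b c d = ∨-comm ((a == c) ∧ (b == d)) ((a == d) ∧ (b == c))

-- Entries are functions on the natural numbers, so the equation of sizes can be matched on without
-- transporting any index.
Nullity-resize : ∀ {N N′} → N ≡ N′ → {f f′ : ℕ → ℕ → ℚ} → (∀ a b → f a b ≡ f′ a b) → ∀ {d} →
  Nullity {N′} (λ i j → f′ (toℕ i) (toℕ j)) d → Nullity {N} (λ i j → f (toℕ i) (toℕ j)) d
Nullity-resize refl f≗f′ = Nullity-cong (λ i j → sym (f≗f′ (toℕ i) (toℕ j)))

unit-product-1 : ∀ {s t} → IsUnit t → s * t ≡ 1ℚ → t ≡ s
unit-product-1 {s} {t} u e = trans (trans (sym (*-identityˡ t)) (cong (_* t) (sym e)))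
  (trans (*-assoc s t t) (trans (cong (s *_) (unit-square u)) (*-identityʳ s)))

unit-product--1 : ∀ {s t} → IsUnit t → s * t ≡ - 1ℚ → t ≡ - s
unit-product--1 {s} {t} u e = unit-product-1 u (trans (sym (neg-distribˡ-* s t)) (cong -_ e))

-- Identification with the given graph and its two cycles

module InfinityGraph (m L n : ℕ) (1≤m : 1 ≤ m) (1≤n : 1 ≤ n)
  (σ : ℕ → ℕ → Sign) (σ-sym : Symmetric σ) where

  open Cases m L n 1≤m 1≤n σ σ-sym public

  p q l c : ℕ
  p = suc (suc m)
  q = suc (suc n)
  l = suc L
  c = qStart p l

  module Cp = CycleSign m 1≤m σ σ-sym
  module Cq = CycleSign n 1≤n (shift c σ) (λ a b → σ-sym (c ℕ.+ a) (c ℕ.+ b))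

  private
    start≡ : c ≡ r
    start≡ = trans (ℕ.+-suc m L) (cong suc (ℕ.+-comm m L))

    size≡ : numVertices p q l ≡ suc (suc k)
    size≡ = rearrange m n L
      where
      rearrange : ∀ m n L → m ℕ.+ suc (suc n) ℕ.+ suc L ≡ suc (suc (n ℕ.+ suc (L ℕ.+ m)))
      rearrange = ℕ-Solver.solve-∀

    last≡ : p ℕ.+ q ℕ.+ l ℕ.∸ 3 ≡ suc k
    last≡ = cong (ℕ._∸ 1) size≡

    last≡c+ : p ℕ.+ q ℕ.+ l ℕ.∸ 3 ≡ c ℕ.+ suc n
    last≡c+ = trans last≡ (trans (cong suc (ℕ.+-comm n r)) (trans (sym (ℕ.+-suc r n)) (cong (ℕ._+ suc n) (sym start≡))))

  entry≡ : ∀ a b → entry p q l σ a b ≡ (if pathAnd chords a b then sgn (σ a b) else 0ℚ)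
  entry≡ a b = cong₂ (λ r k → if (suc a == b) ∨ (suc b == a) ∨ isPair a b 0 (suc m) ∨ isPair a b r k
    then sgn (σ a b) else 0ℚ) start≡ last≡

  adjG-nullity : ∀ {d} → Nullity matrix d → Nullity (adjG p q l σ) d
  adjG-nullity = Nullity-resize size≡ entry≡

  -- The closing edge of the second cycle ends at the last vertex, which lies outside the first
  -- cycle even when the cycles share a vertex.
  Cp-edge : ∀ a b → a < p → b < p → isEdge p q l a b ≡ pathAnd Cp.closing a b
  Cp-edge a b a<p b<p = cong (λ t → (suc a == b) ∨ (suc b == a) ∨ t)
    (trans (cong (isPair a b 0 (suc m) ∨_) (isPair-none (below a a<p) (below b b<p))) (∨-identityʳ _))
    where
    below : ∀ a → a < p → a ≢ p ℕ.+ q ℕ.+ l ℕ.∸ 3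
    below a a<p e = ℕ.<⇒≢ (ℕ.<-≤-trans a<p (s≤s (ℕ.≤-trans (s≤s (ℕ.m≤n+m m L)) (ℕ.m≤n+m r n)))) (trans e last≡)

  -- The closing edge of the first cycle ends at vertex 0, which lies before the start of the
  -- second.
  Cq-edge : ∀ a b → isEdge p q l (c ℕ.+ a) (c ℕ.+ b) ≡ pathAnd Cq.closing a b
  Cq-edge a b = cong₂ _∨_ (successor a b) (cong₂ _∨_ (successor b a) (cong₂ _∨_
    (trans (isPair-comm (c ℕ.+ a) (c ℕ.+ b) 0 (suc m)) (isPair-none (positive a) (positive b)))
    (trans (cong (isPair (c ℕ.+ a) (c ℕ.+ b) c) last≡c+) (isPair-shift c a b (suc n)))))
    where
    successor : ∀ a b → (suc (c ℕ.+ a) == (c ℕ.+ b)) ≡ (suc a == b)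
    successor a b = trans (cong (_== (c ℕ.+ b)) (sym (ℕ.+-suc c a))) (==-shift c (suc a) b)
    positive : ∀ a → c ℕ.+ a ≢ 0
    positive a e = contradiction (trans (cong (ℕ._+ a) (sym start≡)) e) (λ ())

  adjCp-nullity : ∀ {d} → Nullity (adjCp p q l σ) d → Nullity Cp.cycle d
  adjCp-nullity = Nullity-cong (λ i j → cong (λ t → if t then sgn (σ (toℕ i) (toℕ j)) else 0ℚ)
    (Cp-edge (toℕ i) (toℕ j) (Fin.toℕ<n i) (Fin.toℕ<n j)))

  adjCq-nullity : ∀ {d} → Nullity (adjCq p q l σ) d → Nullity Cq.cycle d
  adjCq-nullity = Nullity-cong (λ i j → cong (λ t → if t then sgn (shift c σ (toℕ i) (toℕ j)) else 0ℚ)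
    (Cq-edge (toℕ i) (toℕ j)))

  β≡γ : β ≡ Cq.γ
  β≡γ = trans (cong₂ (chordSign σ) (sym start≡) (trans (sym last≡) last≡c+)) (chordSign-shift σ c (suc n))

  sg-sCp : sg (sCp p q l σ) ≡ α
  sg-sCp = trans (cong sg (sumℕ-cong p (λ b b<p → sumℕ-cong b (λ a a<b →
    cong (λ t → b2n (t ∧ isNeg (σ a b))) (Cp-edge a b (ℕ.<-trans a<b b<p) b<p))))) Cp.sg-negatives

  sg-sCq : sg (sCq p q l σ) ≡ β
  sg-sCq = trans (cong sg (sumℕ-cong q (λ b _ → sumℕ-cong b (λ a _ →
    cong (λ t → b2n (t ∧ isNeg (shift c σ a b))) (Cq-edge a b))))) (trans Cq.sg-negatives (sym β≡γ))

  d = ((ℤ.+ sCp p q l σ) - (ℤ.+ sCq p q l σ)) +ℤ ((ℤ.+ (q / 2)) - (ℤ.+ (p / 2)))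

  -- Translates the parity condition: the sign of `d` is the product of the two `κ`, so an even `d`
  -- means equal and an odd `d` opposite slope signs.
  sg-d : ∀ {h h′} → p / 2 ≡ suc h → q / 2 ≡ suc h′ → sg ∣ d ∣ ≡ (α * sg (suc h)) * (β * sg (suc h′))
  sg-d p/2≡ q/2≡ = trans (sg-difference (sCp p q l σ) (sCq p q l σ) (q / 2) (p / 2))
    (cong₂ _*_ (cong₂ _*_ sg-sCp (cong sg p/2≡)) (cong₂ _*_ sg-sCq (cong sg q/2≡)))

  -- Cycles of different parity are treated for every path length at once.
  middle : Middle
  middle with even⊎odd L
    where
    even⊎odd : ∀ i → (∃ λ h → i ≡ h ℕ.* 2) ⊎ (∃ λ h → i ≡ suc (h ℕ.* 2))
    even⊎odd zero = inj₁ (0 , refl)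
    even⊎odd (suc i) with even⊎odd i
    ... | inj₁ (h , e) = inj₂ (h , cong suc e)
    ... | inj₂ (h , e) = inj₁ (suc h , cong suc e)
  ... | inj₁ (h , L≡) = inj₁ (straight h L≡)
  ... | inj₂ (h , L≡) = inj₂ (crossed h L≡)

  odd-l : l % 2 ≡ 1 → Straight
  odd-l e = straight (proj₁ (odd-pred L e)) (proj₂ (odd-pred L e))

  even-l : l % 2 ≡ 0 → Crossed
  even-l e = crossed (proj₁ (even-pred L e)) (proj₂ (even-pred L e))

  module OddP (p-odd : p % 2 ≡ 1) where
    h = proj₁ (odd-half m p-odd)
    p/2≡ = proj₂ (proj₂ (odd-half m p-odd))
    κ = α * sg (suc h)
    leftOdd : LeftOdd κ
    leftOdd = left-odd h (proj₁ (proj₂ (odd-half m p-odd)))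

  module OddQ (q-odd : q % 2 ≡ 1) where
    h = proj₁ (odd-half n q-odd)
    q/2≡ = proj₂ (proj₂ (odd-half n q-odd))
    κ = β * sg (suc h)
    κ-unit : IsUnit κ
    κ-unit = unit-* β-unit (sg-unit (suc h))
    rightOdd : RightOdd κ
    rightOdd = right-odd h (proj₁ (proj₂ (odd-half n q-odd)))

  module EvenP (p-even : p % 2 ≡ 0) where
    h = proj₁ (even-half m p-even)
    m≡ = proj₂ (even-half m p-even)
    unmatched : Nullity (adjCp p q l σ) 0 → LeftUnmatched
    unmatched η = left-unmatched h m≡ (Cp.nullity-0⇒unmatched h m≡ (adjCp-nullity η))
    matched : Nullity (adjCp p q l σ) 2 → LeftMatched
    matched η = left-matched h m≡ (Cp.nullity-2⇒matched h m≡ (adjCp-nullity η))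
    dichotomy : LeftUnmatched ⊎ LeftMatched
    dichotomy with unit-dichotomy α-unit (sg-unit h)
    ... | inj₁ α≡ = inj₁ (left-unmatched h m≡ α≡)
    ... | inj₂ α≡ = inj₂ (left-matched h m≡ α≡)

  module EvenQ (q-even : q % 2 ≡ 0) where
    h = proj₁ (even-half n q-even)
    n≡ = proj₂ (even-half n q-even)
    unmatched : Nullity (adjCq p q l σ) 0 → RightUnmatched
    unmatched η = right-unmatched h n≡ (trans β≡γ (Cq.nullity-0⇒unmatched h n≡ (adjCq-nullity η)))
    matched : Nullity (adjCq p q l σ) 2 → RightMatched
    matched η = right-matched h n≡ (trans β≡γ (Cq.nullity-2⇒matched h n≡ (adjCq-nullity η)))
    dichotomy : RightUnmatched ⊎ RightMatched
    dichotomy with unit-dichotomy β-unit (sg-unit h)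
    ... | inj₁ β≡ = inj₁ (right-unmatched h n≡ β≡)
    ... | inj₂ β≡ = inj₂ (right-matched h n≡ β≡)

  odd-odd-same : (p-odd : p % 2 ≡ 1) (q-odd : q % 2 ≡ 1) → Straight → ∣ d ∣ % 2 ≡ 0 → Nullity matrix 0
  odd-odd-same p-odd q-odd mid e = odd-odd-balanced (OddP.leftOdd p-odd)
    (subst RightOdd (unit-product-1 (OddQ.κ-unit q-odd)
      (trans (sym (sg-d (OddP.p/2≡ p-odd) (OddQ.q/2≡ q-odd))) (sg-even ∣ d ∣ e)))
      (OddQ.rightOdd q-odd)) mid

  odd-odd-opposite : (p-odd : p % 2 ≡ 1) (q-odd : q % 2 ≡ 1) → Straight → ∣ d ∣ % 2 ≡ 1 → Nullity matrix 1
  odd-odd-opposite p-odd q-odd mid e = odd-odd-unbalanced (OddP.leftOdd p-odd)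
    (subst RightOdd (unit-product--1 (OddQ.κ-unit q-odd)
      (trans (sym (sg-d (OddP.p/2≡ p-odd) (OddQ.q/2≡ q-odd))) (sg-odd ∣ d ∣ e)))
      (OddQ.rightOdd q-odd)) mid

  unmatched-straight : LeftUnmatched → RightUnmatched ⊎ RightMatched → Straight → Nullity matrix 1
  unmatched-straight left (inj₁ right) = unmatched-unmatched-straight left right
  unmatched-straight left (inj₂ right) = unmatched-matched-straight left right

  straight-unmatched : LeftUnmatched ⊎ LeftMatched → RightUnmatched → Straight → Nullity matrix 1
  straight-unmatched (inj₁ left) right = unmatched-unmatched-straight left right
  straight-unmatched (inj₂ left) right = matched-unmatched-straight left right

  matched-crossed : LeftMatched → RightUnmatched ⊎ RightMatched → Crossed → Nullity matrix 2
  matched-crossed left (inj₁ right) = matched-unmatched-crossed left right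
  matched-crossed left (inj₂ right) = matched-matched-crossed left right

  crossed-matched : LeftUnmatched ⊎ LeftMatched → RightMatched → Crossed → Nullity matrix 2
  crossed-matched (inj₁ left) right = unmatched-matched-crossed left right
  crossed-matched (inj₂ left) right = matched-matched-crossed left right

open import Data.Integer using (+_)
theorem4p1 : (p q l : ℕ) → 3 ≤ p → 3 ≤ q → 1 ≤ l →
   (σ : ℕ → ℕ → Sign) → Symmetric σ →
   let A  = adjG p q l σ
       Ap = adjCp p q l σ
       Aq = adjCq p q l σ
       -- s(Γ(C_p)) - s(Γ(C_q)) + (q - p)/2, with (q-p)/2 = ⌊q/2⌋ - ⌊p/2⌋ for p, q odd
       d  = ((+ sCp p q l σ) - (+ sCq p q l σ)) +ℤ ((+ (q / 2)) - (+ (p / 2)))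
   in
   -- (1) p, q both odd
   ((p % 2 ≡ 1 → q % 2 ≡ 1 →
       (l % 2 ≡ 0 → Nullity A 0)
     × (l % 2 ≡ 1 → ∣ d ∣ % 2 ≡ 0 → Nullity A 0)
     × (l ≡ 1 → ∣ d ∣ % 2 ≡ 1 → Nullity A 1)
     × (3 ≤ l → l % 2 ≡ 1 → ∣ d ∣ % 2 ≡ 1 → NullityAtLeast A 1))
   -- (2) different parities (both labellings)
   × (p % 2 ≡ 0 → q % 2 ≡ 1 →
       (Nullity Ap 0 → Nullity A 0) × (Nullity Ap 2 → Nullity A 1))
   × (q % 2 ≡ 0 → p % 2 ≡ 1 →
       (Nullity Aq 0 → Nullity A 0) × (Nullity Aq 2 → Nullity A 1))
   -- (3) p, q both even
   × (p % 2 ≡ 0 → q % 2 ≡ 0 →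
       (l % 2 ≡ 1 → Nullity Ap 2 → Nullity Aq 2 → Nullity A 3)
     × (l % 2 ≡ 1 → (a b : ℕ) → Nullity Ap a → Nullity Aq b → a ℕ.* b ≡ 0 → Nullity A 1)
     × (l % 2 ≡ 0 → (Nullity Ap 2 ⊎ Nullity Aq 2) → Nullity A 2)
     × (l % 2 ≡ 0 → Nullity Ap 0 → Nullity Aq 0 → Nullity A 0)))
theorem4p1 (suc (suc m)) (suc (suc n)) (suc L) (s≤s (s≤s 1≤m)) (s≤s (s≤s 1≤n)) _ σ σ-sym =
   (λ p-odd q-odd →
       (λ l-even → adjG-nullity (odd-odd-crossed (OddQ.κ-unit q-odd)
          (OddP.leftOdd p-odd) (OddQ.rightOdd q-odd) (even-l l-even)))
     , (λ l-odd d-even → adjG-nullity (odd-odd-same p-odd q-odd (odd-l l-odd) d-even))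
     , (λ l≡1 d-odd → adjG-nullity (odd-odd-opposite p-odd q-odd (odd-l (cong (_% 2) l≡1)) d-odd))
     , (λ _ l-odd d-odd → proj₁ (adjG-nullity (odd-odd-opposite p-odd q-odd (odd-l l-odd) d-odd))))
   , (λ p-even q-odd →
       (λ η → adjG-nullity (unmatched-odd (OddQ.κ-unit q-odd) (EvenP.unmatched p-even η) (OddQ.rightOdd q-odd) middle))
     , (λ η → adjG-nullity (matched-odd (OddQ.κ-unit q-odd) (EvenP.matched p-even η) (OddQ.rightOdd q-odd) middle)))
   , (λ q-even p-odd →
       (λ η → adjG-nullity (odd-unmatched (OddP.leftOdd p-odd) (EvenQ.unmatched q-even η) middle))
     , (λ η → adjG-nullity (odd-matched (OddP.leftOdd p-odd) (EvenQ.matched q-even η) middle)))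
   , (λ p-even q-even →
       (λ l-odd ηp ηq → adjG-nullity (matched-matched-straight
          (EvenP.matched p-even ηp) (EvenQ.matched q-even ηq) (odd-l l-odd)))
     -- A vanishing product has a zero factor, which makes that cycle unmatched; the other cycle may
     -- be of either kind, hence `dichotomy`.
     , (λ { l-odd zero b ηp ηq _ → adjG-nullity (unmatched-straight
               (EvenP.unmatched p-even ηp) (EvenQ.dichotomy q-even) (odd-l l-odd))
          ; l-odd (suc a) zero ηp ηq _ → adjG-nullity (straight-unmatched
               (EvenP.dichotomy p-even) (EvenQ.unmatched q-even ηq) (odd-l l-odd)) })
     , (λ { l-even (inj₁ ηp) → adjG-nullity (matched-crossed
               (EvenP.matched p-even ηp) (EvenQ.dichotomy q-even) (even-l l-even))
          ; l-even (inj₂ ηq) → adjG-nullity (crossed-matched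
               (EvenP.dichotomy p-even) (EvenQ.matched q-even ηq) (even-l l-even)) })
     , (λ l-even ηp ηq → adjG-nullity (unmatched-unmatched-crossed
          (EvenP.unmatched p-even ηp) (EvenQ.unmatched q-even ηq) (even-l l-even))))
  where open InfinityGraph m L n 1≤m 1≤n σ σ-sym
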